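{- Let $G=(V,E,w)$ be a weighted undirected graph with $n=|V|$ vertices. There is a randomized algorithm that, given $\ell$ and $W$, constructs an $\ell$-limited $W$-pairwise cover of $G$ in $O(\ell\,\log^2(n)\,\log(W))$ rounds in the CONGEST model, with high probability. Moreover, a pairwise cover for paths with at most $\ell$ hops and with length in $[W,2W]$ can be constructed in $O(\ell\log^2 n)$ rounds in the CONGEST model, with high probability.
   Context: Edge weights are positive, normalized so that the minimum edge weight is at least $1$, and polynomially bounded in $n$. $n=|V|$, $m=|E|$. The notation $\tilde O(f(n))$ hides polylogarithmic factors. The length of a path is its total weight; its number of hops is its number of edges. **$\ell$-limited $W$-pairwise cover.** A collection $\mathcal C$ of subsets of $V$ (clusters) such that: 1. the diameter of each cluster (with respect to $w$) is $O(W\log n)$; 2. $\sum_{C\in\mathcal C}|C|=\tilde O(n)$ and $\sum_{C\in\mathcal C}|E(C)|=\tilde O(m)$, where $E(C)$ is the set of edges of $G$ with both endpoints in $C$; 3. for every path $p$ in $G$ with at most $\ell$ hops and length at most $W$ there is a cluster $C\in\mathcal C$ with $p\subseteq C$ (all vertices of $p$ lie in $C$). A **pairwise cover for paths with at most $\ell$ hops and length in $[W,2W]$** is a collection satisfying 1 and 2, and satisfying 3 for all paths $p$ with at most $\ell$ hops and length in $[W,2W]$ (instead of length at most $W$). **CONGEST model.** The communication network is $G$ itself. Initially each node knows its incident edges and their weights. In each synchronous round each node may send a message of $O(\log n)$ bits to each of its neighbors in $G$ (different messages along different edges). Local computation is free. Constructing a cover means that each node learns which clusters it belongs to. "With high probability"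 means with probability at least $1-n^{ -c}$ for an arbitrary fixed constant $c>0$.
   Formalization: The edge weights w and the length parameter W are taken to be rational numbers instead of real numbers. -}

module Defs where

open import Data.Bool using (Bool; T?)
open import Data.Fin using (Fin; _<?_)
open import Data.Fin.Subset using (Subset; ∣_∣) renaming (_∈_ to _∈ˢ_)
open import Data.Fin.Subset.Properties using (_∈?_)
open import Data.Integer using (+_) renaming (∣_∣ to abs)
open import Data.List as List using (List; []; _∷_; allFin; cartesianProduct; filter)
open import Data.List.Relation.Unary.All using (All)
open import Data.List.Relation.Unary.Unique.Propositional using (Unique)
open import Data.Maybe using (Maybe; just; nothing; is-just; maybe′)
open import Data.Nat as ℕ using (ℕ; zero; suc)
open import Data.Nat.Logarithm using (⌈log₂_⌉)
open import Data.Product using (_×_; _,_; ∃-syntax)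
open import Data.Rational as ℚ using (ℚ; 0ℚ; 1ℚ; _/_; ceiling)
open import Data.Vec as Vec using (Vec; lookup; tabulate; transpose)
open import Data.Vec.Bounded as Vec≤ using (Vec≤)
import Data.Vec.Relation.Unary.All as VecAll
import Data.Vec.Relation.Unary.Any as VecAny
open import Relation.Binary.PropositionalEquality using (_≡_)
open import Relation.Nullary.Decidable using (_×-dec_)

fromℕ : ℕ → ℚ
fromℕ k = + k / 1

-- Clamped at 0 for arguments in (0, 1].
⌈log₂ℚ_⌉ : ℚ → ℕ
⌈log₂ℚ W ⌉ = ⌈log₂ abs (ceiling W) ⌉

------------------------------------------------------------------------
-- Weighted graphs

-- weight u v ≡ nothing means that u and v are not adjacent.
record WeightedGraph (n : ℕ) : Set where
  field
    weight    : Fin n → Fin n → Maybe ℚ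
    symmetric : ∀ u v → weight u v ≡ weight v u
    loopless  : ∀ v → weight v v ≡ nothing
    weight≥1  : ∀ u v {x} → weight u v ≡ just x → 1ℚ ℚ.≤ x

open WeightedGraph public

PolynomiallyBounded : ∀ {n} → ℕ → WeightedGraph n → Set
PolynomiallyBounded {n} d G =
  ∀ u v {x} → weight G u v ≡ just x → x ℚ.≤ fromℕ (n ℕ.^ d)

-- Each undirected edge {u , v} is listed once, as (u , v) with u < v.
edges : ∀ {n} → WeightedGraph n → List (Fin n × Fin n)
edges {n} G =
  filter (λ (u , v) → (u <? v) ×-dec T? (is-just (weight G u v)))
         (cartesianProduct (allFin n) (allFin n))

edgesWithin : ∀ {n} → WeightedGraph n → Subset n → List (Fin n × Fin n)
edgesWithin G C = filter (λ (u , v) → (u ∈? C) ×-dec (v ∈? C)) (edges G)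

data Walk {n : ℕ} (G : WeightedGraph n) : Fin n → Fin n → Set where
  nil  : ∀ {v} → Walk G v v
  step : ∀ {u v z x} → weight G u v ≡ just x → Walk G v z → Walk G u z

module _ {n : ℕ} {G : WeightedGraph n} where

  hops : ∀ {u v} → Walk G u v → ℕ
  hops nil        = 0
  hops (step _ p) = suc (hops p)

  length : ∀ {u v} → Walk G u v → ℚ
  length nil                = 0ℚ
  length (step {x = x} _ p) = x ℚ.+ length p

  vertices : ∀ {u v} → Walk G u v → List (Fin n)
  vertices (nil {v})          = v ∷ []
  vertices (step {u = u} _ p) = u ∷ vertices p

  IsPath : ∀ {u v} → Walk G u v → Set
  IsPath p = Unique (vertices p)

  _⊆ᵖ_ : ∀ {u v} → Walk G u v → Subset n → Set
  p ⊆ᵖ C = All (_∈ˢ C) (vertices p)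

-- The diameter is that of the induced subgraph G[C]: connecting walks have
-- to stay inside C.
Diameter≤ : ∀ {n} → WeightedGraph n → Subset n → ℚ → Set
Diameter≤ G C D =
  ∀ u v → u ∈ˢ C → v ∈ˢ C → ∃[ p ] ((p ⊆ᵖ C) × length {G = G} {u} {v} p ℚ.≤ D)

------------------------------------------------------------------------
-- Pairwise covers

PathClass : ∀ {n} → WeightedGraph n → Set₁
PathClass G = ∀ {u v} → Walk G u v → Set

-- K is the constant in every O(·) and Õ(·), and e the exponent of the
-- logarithm hidden by Õ(·).
record IsPairwiseCover {n N : ℕ} (K e : ℕ) (G : WeightedGraph n) (W : ℚ)
                       (Covered : PathClass G)
                       (𝒞 : Vec (Subset n) N) : Set where
  field
    diameter  : VecAll.All
                  (λ C → Diameter≤ G C (fromℕ (K ℕ.* ⌈log₂ n ⌉) ℚ.* W)) 𝒞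
    vertexSum : Vec.sum (Vec.map ∣_∣ 𝒞) ℕ.≤ K ℕ.* (n ℕ.* ⌈log₂ n ⌉ ℕ.^ e)
    edgeSum   : Vec.sum (Vec.map (λ C → List.length (edgesWithin G C)) 𝒞)
                  ℕ.≤ K ℕ.* (List.length (edges G) ℕ.* ⌈log₂ n ⌉ ℕ.^ e)
    covers    : ∀ {u v} (p : Walk G u v) → IsPath p → Covered p →
                VecAny.Any (p ⊆ᵖ_) 𝒞

IsLimitedPairwiseCover : ∀ {n N} (K e : ℕ) (G : WeightedGraph n) (ℓ : ℕ)
                         (W : ℚ) → Vec (Subset n) N → Set
IsLimitedPairwiseCover K e G ℓ W =
  IsPairwiseCover K e G W (λ p → hops p ℕ.≤ ℓ × length p ℚ.≤ W)

IsScalePairwiseCover : ∀ {n N} (K e : ℕ) (G : WeightedGraph n) (ℓ : ℕ)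
                       (W : ℚ) → Vec (Subset n) N → Set
IsScalePairwiseCover K e G ℓ W =
  IsPairwiseCover K e G W
    (λ p → hops p ℕ.≤ ℓ × W ℚ.≤ length p × length p ℚ.≤ fromℕ 2 ℚ.* W)

------------------------------------------------------------------------
-- Randomized CONGEST algorithms that construct clusters

Message : ℕ → Set
Message b = Vec≤ Bool b

-- Sending the empty bit string counts as sending nothing.
silence : ∀ {b} → Message b
silence = Vec≤.[]

-- A program for n nodes and messages of at most b bits.  A node starts with
-- its own name, its incident edges with their weights, and private fair coin
-- flips; it ends with the set of names of the clusters it belongs to.
record Algorithm (n b : ℕ) : Set₁ where
  field
    rounds  : ℕ
    coins   : ℕ
    labels  : ℕ
    State   : Set
    init    : Fin n → (Fin n → Maybe ℚ) → Vec Bool coins → State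
    send    : State → Fin n → Message b
    receive : State → (Fin n → Message b) → State
    output  : State → Subset labels

open Algorithm public

module _ {n b : ℕ} (A : Algorithm n b) (G : WeightedGraph n) where

  Outcome : Set
  Outcome = Vec (Vec Bool (coins A)) n

  -- Messages travel along edges of G only.
  inbox : (Fin n → State A) → Fin n → Fin n → Message b
  inbox s v u = maybe′ (λ _ → send A (s u) v) silence (weight G u v)

  stateAfter : ℕ → Outcome → Fin n → State A
  stateAfter zero    ω v = init A v (weight G v) (lookup ω v)
  stateAfter (suc t) ω v = receive A (stateAfter t ω v) (inbox (stateAfter t ω) v)

  -- The i-th cluster consists of the nodes that output the name i.
  clusters : Outcome → Vec (Subset n) (labels A)
  clusters ω = transpose (tabulate (λ v → output A (stateAfter (rounds A) ω v)))

  -- Pr[P] ≥ 1 - n^{-c}, multiplied by n^c times the number 2^(n · coins) of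
  -- equally likely outcomes.
  WithHighProbability : ℕ → (Outcome → Set) → Set
  WithHighProbability c P =
    ∃[ good ] (Unique good × All P good ×
      n ℕ.^ c ℕ.* 2 ℕ.^ (n ℕ.* coins A)
        ℕ.≤ n ℕ.^ c ℕ.* List.length good ℕ.+ 2 ℕ.^ (n ℕ.* coins A))

  ConstructsWHP : ℕ → (∀ {N} → Vec (Subset n) N → Set) → Set
  ConstructsWHP c Cover = WithHighProbability c (λ ω → Cover (clusters ω))

-- A program for each value of the parameters known to all nodes: n, ℓ and W.
AlgorithmFamily : ℕ → Set₁
AlgorithmFamily B = (n ℓ : ℕ) (W : ℚ) → Algorithm n (B ℕ.* ⌈log₂ n ⌉)

{-# OPTIONS --safe #-}
-- Weights are rounded up to multiples of W / ℓ, so that a path with at most ℓ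
-- hops and length at most 2W costs at most 3ℓ units, while a walk of cost kℓ
-- has length at most kW.  On the rounded graph O(log n) independent trials of
-- the clustering of Miller, Peng and Xu are run, each of O(ℓ log n) rounds:
-- every node starts a wave at a random time, made earlier by 7ℓ for each
-- leading head among its 2 log n coins, and every node joins the wave that
-- reaches it first.  A cluster is connected through the walks of its wave,
-- hence has diameter O(W log n), and each node is in one cluster per trial.
-- If at u the first wave arrives more than 6ℓ before all the others, then that
-- wave also captures the ball of radius 3ℓ around u, hence every path to be
-- covered that starts at u.  One more head for the first wave creates such a
-- gap, so that, up to truncation, the outcomes without a gap inject into those
-- with a gap; a trial fails for u with probability at most 3/4.
module Submission where

open import Defs
open import Data.Bool as Bool using (Bool; true; false; if_then_else_)
open import Data.Bool.Properties using () renaming (_≟_ to _≟ᵇ_)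
open import Data.Fin using (Fin; zero; suc; combine; fromℕ<; inject≤; remQuot)
open import Data.Fin.Properties
  using (all?; any?; combine-remQuot; inject≤-injective; remQuot-combine; ¬∀⟶∃¬)
  renaming (_≟_ to _≟ᶠ_; suc-injective to suc-injectiveᶠ)
open import Data.Fin.Subset using (Subset; ∣_∣) renaming (_∈_ to _∈ˢ_)
open import Data.Fin.Subset.Properties using (_∈?_)
open import Data.Integer as ℤ using ()
import Data.Integer.Properties as ℤₚ
open import Data.List as List
  using (List; []; _∷_; _++_; allFin; cartesianProduct; cartesianProductWith; concatMap; filter)
open import Data.List.Membership.Propositional using (_∈_)
open import Data.List.Membership.Propositional.Properties
import Data.List.Properties as Listₚ
open import Data.List.Relation.Unary.All as All using (All; []; _∷_)
open import Data.List.Relation.Unary.All.Properties using (all-filter)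
open import Data.List.Relation.Unary.AllPairs using ([]; _∷_)
open import Data.List.Relation.Unary.Any as Any using (here; there)
open import Data.List.Relation.Unary.Unique.Propositional using (Unique)
open import Data.List.Relation.Unary.Unique.Propositional.Properties
  using (++⁺; allFin⁺; cartesianProduct⁺; cartesianProductWith⁺; filter⁺; map⁺)
open import Data.Maybe using (Maybe; just; nothing; maybe′)
open import Data.Maybe.Properties using (just-injective)
open import Data.Nat
import Data.Nat.Coprimality as Coprimality
import Data.Nat.DivMod as DivMod
open import Data.Nat.Logarithm using (⌈log₂_⌉; ⌈log₂⌉-mono-≤; ⌈log₂⌈n/2⌉⌉≡⌈log₂n⌉∸1)
open import Data.Nat.Properties
open import Data.Nat.Tactic.RingSolver using (solve-∀)
open import Data.Product using (Σ; _×_; _,_; proj₁; proj₂; ∃-syntax; Σ-syntax; map₁; uncurry)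
open import Data.Rational as ℚ using (ℚ; mkℚ; 0ℚ; 1ℚ; ↥_; ↧ₙ_; *≤*) renaming (_<_ to _<ℚ_)
import Data.Rational.Properties as ℚₚ
open import Data.Rational.Solver using (module +-*-Solver)
open import Data.Sum using (_⊎_; inj₁; inj₂; [_,_]′)
open import Data.Vec as Vec using (Vec; []; _∷_; _[_]≔_; group; lookup; tabulate; transpose)
open import Data.Vec.Bounded as Vec≤ using (Vec≤)
import Data.Vec.Properties as Vecₚ
import Data.Vec.Relation.Unary.All.Properties as VecAllₚ
import Data.Vec.Relation.Unary.Any as VecAny
open import Function using (_$_; _∘_; id)
open import Relation.Binary.Definitions using (tri<; tri≈; tri>)
open import Relation.Binary.PropositionalEquality
open import Relation.Nullary
open import Relation.Nullary.Decidable using (¬?; _×-dec_; _→-dec_)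
open import Relation.Unary using (Decidable)

-- Counting in finite types

-- Probabilities are counts of coin outcomes here, so the memorylessness of a geometric variable has
-- to appear as an injection: `raise` plays the part of conditioning, and the rare outcomes that
-- leave it no room are counted apart. That count needs offsets fixed before the coins are flipped,
-- whereas in a run the waves swallow one another. Distances are therefore defined without reference
-- to the coins, and the race is compared with them by the triangle inequality alone. This spends
-- the radius 3ℓ twice, whence 6ℓ, and 7ℓ is a multiple of ℓ beyond it. A gap protects a whole ball,
-- so the union bound runs over n nodes instead of exponentially many paths. Rounding up costs one
-- unit per hop, which paths of at most ℓ hops can afford, and it makes the duration of a trial
-- independent of W. A single program serves both claims, since paths of length at most W and paths
-- of length in [W, 2W] all have length at most 2W.

length-cartesianProductWith : ∀ {A B C : Set} (f : A → B → C) xs ys →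
  List.length (cartesianProductWith f xs ys) ≡ List.length xs * List.length ys
length-cartesianProductWith f []       ys = refl
length-cartesianProductWith f (x ∷ xs) ys = trans
  (Listₚ.length-++ (List.map (f x) ys))
  (cong₂ _+_ (Listₚ.length-map (f x) ys) (length-cartesianProductWith f xs ys))

length-filter-¬ : ∀ {A : Set} {P : A → Set} (P? : Decidable P) xs →
  List.length (filter P? xs) + List.length (filter (¬? ∘ P?) xs) ≡ List.length xs
length-filter-¬ P? []       = refl
length-filter-¬ P? (x ∷ xs) with P? x
... | yes _ = cong suc (length-filter-¬ P? xs)
... | no _  = trans (+-suc _ _) (cong suc (length-filter-¬ P? xs))

-- Stated for a relation, so that an injection may be partial and need not be
-- computed.
pigeonhole : ∀ {A B : Set} (R : A → B → Set) {xs ys} → Unique xs →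
  (∀ {x} → x ∈ xs → ∃[ y ] (y ∈ ys × R x y)) →
  (∀ {x x′ y} → R x y → R x′ y → x ≡ x′) →
  List.length xs ≤ List.length ys
pigeonhole R []                        tot inj = z≤n
pigeonhole R {x ∷ xs} (x∉xs ∷ xs-unique) tot inj
  with y , y∈ys , Rxy ← tot (here refl)
  with as , bs , refl ← ∈-∃++ y∈ys
  = subst (suc (List.length xs) ≤_) (sym (Listₚ.length-++-sucʳ as y bs))
      (s≤s (pigeonhole R xs-unique tot′ inj))
  where
  tot′ : ∀ {x′} → x′ ∈ xs → ∃[ y′ ] (y′ ∈ as ++ bs × R x′ y′)
  tot′ x′∈xs with tot (there x′∈xs)
  ... | y′ , y′∈ , Rx′y′ with ∈-++⁻ as y′∈
  ... | inj₁ y′∈as         = y′ , ∈-++⁺ˡ y′∈as , Rx′y′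
  ... | inj₂ (there y′∈bs) = y′ , ∈-++⁺ʳ as y′∈bs , Rx′y′
  ... | inj₂ (here refl)   with refl ← inj Rxy Rx′y′ =
    contradiction refl (All.lookup x∉xs x′∈xs)

⊆⇒length≤ : ∀ {A : Set} {xs ys : List A} → Unique xs →
  (∀ {x} → x ∈ xs → x ∈ ys) → List.length xs ≤ List.length ys
⊆⇒length≤ xs-unique xs⊆ys =
  pigeonhole _≡_ xs-unique (λ x∈xs → _ , xs⊆ys x∈xs , refl) (λ p q → trans p (sym q))

vecs : ∀ {A : Set} → List A → ∀ n → List (Vec A n)
vecs xs zero    = [] ∷ []
vecs xs (suc n) = cartesianProductWith _∷_ xs (vecs xs n)

length-vecs : ∀ {A : Set} (xs : List A) n → List.length (vecs xs n) ≡ List.length xs ^ n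
length-vecs xs zero    = refl
length-vecs xs (suc n) = trans (length-cartesianProductWith _∷_ xs (vecs xs n))
  (cong (List.length xs *_) (length-vecs xs n))

∈-vecs : ∀ {A : Set} {xs : List A} {n} (v : Vec A n) →
  (∀ i → lookup v i ∈ xs) → v ∈ vecs xs n
∈-vecs []      v∈ = here refl
∈-vecs (x ∷ v) v∈ = ∈-cartesianProductWith⁺ _∷_ (v∈ zero) (∈-vecs v (v∈ ∘ suc))

vecs-unique : ∀ {A : Set} {xs : List A} → Unique xs → ∀ n → Unique (vecs xs n)
vecs-unique u zero    = [] ∷ []
vecs-unique u (suc n) = cartesianProductWith⁺ _∷_ Vecₚ.∷-injective u (vecs-unique u n)

record Finite (A : Set) : Set where
  field
    elements : List A
    complete : ∀ x → x ∈ elements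
    unique   : Unique elements

  size : ℕ
  size = List.length elements

open Finite

bools : Finite Bool
bools .elements = true ∷ false ∷ []
bools .complete true  = here refl
bools .complete false = there (here refl)
bools .unique = ((λ ()) ∷ []) ∷ [] ∷ []

vectors : ∀ {A} → Finite A → ∀ n → Finite (Vec A n)
vectors F n .elements = vecs (elements F) n
vectors F n .complete v = ∈-vecs v (λ i → complete F (lookup v i))
vectors F n .unique = vecs-unique (unique F) n

size-vectors : ∀ {A} (F : Finite A) n → size (vectors F n) ≡ size F ^ n
size-vectors F n = length-vecs (elements F) n

-- Gaps in a single trial

-- A truncated geometric random variable.
heads : ∀ {L} → Vec Bool L → ℕ
heads []          = 0
heads (true ∷ b)  = suc (heads b)
heads (false ∷ b) = 0

raise : ∀ {L} → Vec Bool L → Vec Bool L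
raise []          = []
raise (true ∷ b)  = true ∷ raise b
raise (false ∷ b) = true ∷ b

heads≤ : ∀ {L} (b : Vec Bool L) → heads b ≤ L
heads≤ []          = z≤n
heads≤ (true ∷ b)  = s≤s (heads≤ b)
heads≤ (false ∷ b) = z≤n

heads-raise : ∀ {L} (b : Vec Bool L) → heads b < L → heads b < heads (raise b)
heads-raise (true ∷ b)  (s≤s lt) = s≤s (heads-raise b lt)
heads-raise (false ∷ b) _        = s≤s z≤n

-- All that `raise` forgets is which coin it flipped, and the number of leading heads is the
-- position of that coin.
raise-injective : ∀ {L} (b b′ : Vec Bool L) → heads b ≡ heads b′ → raise b ≡ raise b′ → b ≡ b′
raise-injective []          []           _  _ = refl
raise-injective (true ∷ b)  (true ∷ b′)  h≡ r≡ =
  cong (true ∷_) (raise-injective b b′ (suc-injective h≡) (Vecₚ.∷-injectiveʳ r≡))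
raise-injective (false ∷ b) (false ∷ b′) h≡ r≡ = cong (false ∷_) (Vecₚ.∷-injectiveʳ r≡)

heads≡L : ∀ {L} (b : Vec Bool L) → L ≤ heads b → b ≡ Vec.replicate L true
heads≡L []         _        = refl
heads≡L (true ∷ b) (s≤s le) = cong (true ∷_) (heads≡L b le)

argmin : ∀ {n} .{{_ : NonZero n}} (f : Fin n → ℕ) → ∃[ v ] (∀ c → f v ≤ f c)
argmin {1} f = zero , λ { zero → ≤-refl }
argmin {suc (suc n)} f with argmin (f ∘ suc)
... | v , v-min with ≤-total (f zero) (f (suc v))
... | inj₁ le = zero  , λ { zero → ≤-refl ; (suc c) → ≤-trans le (v-min c) }
... | inj₂ le = suc v , λ { zero → le ; (suc c) → v-min c }

lookup-ext : ∀ {A : Set} {n} {xs ys : Vec A n} → (∀ i → lookup xs i ≡ lookup ys i) → xs ≡ ys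
lookup-ext {xs = xs} {ys} eq = trans (sym (Vecₚ.tabulate∘lookup xs))
  (trans (Vecₚ.tabulate-cong eq) (Vecₚ.tabulate∘lookup ys))

lookup-ext-at : ∀ {A : Set} {n} {xs ys : Vec A n} v →
  (∀ c → c ≢ v → lookup xs c ≡ lookup ys c) → lookup xs v ≡ lookup ys v → xs ≡ ys
lookup-ext-at {xs = xs} {ys} v off on = lookup-ext pointwise
  where
  pointwise : ∀ c → lookup xs c ≡ lookup ys c
  pointwise c with c ≟ᶠ v
  ... | yes refl = on
  ... | no c≢v   = off c c≢v

module _ (L D : ℕ) where

  launch : Vec Bool L → ℕ
  launch b = D * (L ∸ heads b)

  launch≤ : ∀ b → launch b ≤ D * L
  launch≤ b = *-monoʳ-≤ D (m∸n≤m L (heads b))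

  launch-drop : ∀ {b b′} → heads b < heads b′ → launch b′ + D ≤ launch b
  launch-drop {b} {b′} lt = begin
    D * (L ∸ heads b′) + D     ≡⟨ +-comm _ D ⟩
    D + D * (L ∸ heads b′)     ≡⟨ *-suc D _ ⟨
    D * suc (L ∸ heads b′)     ≤⟨ *-monoʳ-≤ D (∸-monoʳ-< lt (heads≤ b′)) ⟩
    D * (L ∸ heads b)          ∎
    where open ≤-Reasoning

  module _ (ρ : ℕ) (ρ<D : ρ < D) {n : ℕ} .{{_ : NonZero n}} (d : Fin n → ℕ) where

    Ω : Set
    Ω = Vec (Vec Bool L) n

    -- The offsets `d` will be the capped distances to one fixed node, `ρ` will be 6ℓ and `D` will
    -- be 7ℓ. The counting treats `d` as an arbitrary function that does not depend on the coins.
    arrival : Ω → Fin n → ℕ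
    arrival ω v = launch (lookup ω v) + d v

    Gap : Ω → Set
    Gap ω = ∃[ v ] (∀ c → c ≢ v → arrival ω v + ρ < arrival ω c)

    gap? : Decidable Gap
    gap? ω = any? λ v → all? λ c → ¬? (c ≟ᶠ v) →-dec (arrival ω v + ρ <? arrival ω c)

    -- A row without tails cannot be raised. Asking for such a row at any node, not just at the one
    -- that arrives first, leaves a plain union bound.
    Truncated : Ω → Set
    Truncated ω = ∃[ v ] (L ≤ heads (lookup ω v))

    truncated? : Decidable Truncated
    truncated? ω = any? λ v → L ≤? heads (lookup ω v)

    RaisedAt : Fin n → Ω → Ω → Set
    RaisedAt v ω ω′ = (∀ c → arrival ω v ≤ arrival ω c) × heads (lookup ω v) < L
      × ω′ ≡ ω [ v ]≔ raise (lookup ω v)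

    raised-off : ∀ {v ω ω′} → RaisedAt v ω ω′ → ∀ c → c ≢ v → lookup ω′ c ≡ lookup ω c
    raised-off {v} {ω} (_ , _ , refl) c c≢v = Vecₚ.lookup∘update′ c≢v ω _

    raised-on : ∀ {v ω ω′} → RaisedAt v ω ω′ → lookup ω′ v ≡ raise (lookup ω v)
    raised-on {v} {ω} (_ , _ , refl) = Vecₚ.lookup∘update v ω _

    -- No wave beats `v` in `ω₁`; extra heads move `v` earlier by at least `D` while all other
    -- arrivals stay. The two outcomes are arbitrary because this serves both a raised outcome and a
    -- pair of preimages of one outcome.
    earlier⇒gap : ∀ {v ω₁ ω₂} → (∀ c → arrival ω₁ v ≤ arrival ω₁ c) →
      heads (lookup ω₁ v) < heads (lookup ω₂ v) → (∀ c → c ≢ v → lookup ω₂ c ≡ lookup ω₁ c) →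
      ∀ c → c ≢ v → arrival ω₂ v + ρ < arrival ω₂ c
    earlier⇒gap {v} {ω₁} {ω₂} v-min lt off c c≢v = begin-strict
      arrival ω₂ v + ρ              <⟨ +-monoʳ-< (arrival ω₂ v) ρ<D ⟩
      arrival ω₂ v + D              ≡⟨ swap (launch (lookup ω₂ v)) (d v) D ⟩
      launch (lookup ω₂ v) + D + d v ≤⟨ +-monoˡ-≤ (d v) (launch-drop {lookup ω₁ v} lt) ⟩
      arrival ω₁ v                  ≤⟨ v-min c ⟩
      arrival ω₁ c                  ≡⟨ cong (λ b → launch b + d c) (off c c≢v) ⟨
      arrival ω₂ c                  ∎
      where
      open ≤-Reasoning
      swap : ∀ s d D → s + d + D ≡ s + D + d
      swap = solve-∀

    raised-gap : ∀ {v ω ω′} → RaisedAt v ω ω′ → ∀ c → c ≢ v → arrival ω′ v + ρ < arrival ω′ c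
    raised-gap {v} {ω} {ω′} r@(v-min , lt , _) = earlier⇒gap {v} {ω} {ω′} v-min
      (subst (λ b → heads (lookup ω v) < heads b) (sym (raised-on r)) (heads-raise _ lt))
      (raised-off r)

    -- For the injection this recovers, from a raised outcome alone, the node that was raised.
    gap-unique : ∀ {ω v v′} → (∀ c → c ≢ v → arrival ω v + ρ < arrival ω c) →
      (∀ c → c ≢ v′ → arrival ω v′ + ρ < arrival ω c) → v ≡ v′
    gap-unique {ω} {v} {v′} g g′ with v ≟ᶠ v′
    ... | yes eq = eq
    ... | no neq = contradiction
      (<-trans (m+n≤o⇒m≤o (suc (arrival ω v)) (g v′ (neq ∘ sym)))
               (m+n≤o⇒m≤o (suc (arrival ω v′)) (g′ v neq))) (<-irrefl refl)

    raised-low⇒gap : ∀ {v ω₁ ω₂ ω′} → RaisedAt v ω₁ ω′ → RaisedAt v ω₂ ω′ →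
      heads (lookup ω₁ v) < heads (lookup ω₂ v) → Gap ω₂
    raised-low⇒gap {v} {ω₁} {ω₂} r₁ r₂ lt = v , earlier⇒gap {v} {ω₁} {ω₂} (proj₁ r₁) lt
      λ c c≢v → trans (sym (raised-off r₂ c c≢v)) (raised-off r₁ c c≢v)

    Raised : Ω → Ω → Set
    Raised ω ω′ = ¬ Gap ω × ∃[ v ] RaisedAt v ω ω′

    -- The number of heads at v is recovered: of two preimages with different
    -- numbers, the one with more heads would already have a gap.
    raised-injective : ∀ {ω₁ ω₂ ω′} → Raised ω₁ ω′ → Raised ω₂ ω′ → ω₁ ≡ ω₂
    raised-injective {ω₁} {ω₂} {ω′} (¬g₁ , v , r₁) (¬g₂ , v₂ , r₂)
      with refl ← gap-unique {ω′} (raised-gap r₁) (raised-gap r₂)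
      with <-cmp (heads (lookup ω₁ v)) (heads (lookup ω₂ v))
    ... | tri< lt _ _ = contradiction (raised-low⇒gap r₁ r₂ lt) ¬g₂
    ... | tri> _ _ gt = contradiction (raised-low⇒gap r₂ r₁ gt) ¬g₁
    ... | tri≈ _ eq _ = lookup-ext-at v
      (λ c c≢v → trans (sym (raised-off r₁ c c≢v)) (raised-off r₂ c c≢v))
      (raise-injective _ _ eq (trans (sym (raised-on r₁)) (raised-on r₂)))

    coinRows : Finite (Vec Bool L)
    coinRows = vectors bools L

    outcomes₁ : Finite Ω
    outcomes₁ = vectors coinRows n

    gaps nonGaps : List Ω
    gaps    = filter gap? (elements outcomes₁)
    nonGaps = filter (¬? ∘ gap?) (elements outcomes₁)

    nonGaps-split : List.length nonGaps ≤
      List.length (filter truncated? nonGaps) + List.length gaps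
    nonGaps-split = begin
      List.length nonGaps ≡⟨ length-filter-¬ truncated? nonGaps ⟨
      List.length (filter truncated? nonGaps) + List.length (filter (¬? ∘ truncated?) nonGaps)
        ≤⟨ +-monoʳ-≤ (List.length (filter truncated? nonGaps))
             (pigeonhole Raised
               (filter⁺ (¬? ∘ truncated?) (filter⁺ (¬? ∘ gap?) (unique outcomes₁)))
               total raised-injective) ⟩
      List.length (filter truncated? nonGaps) + List.length gaps ∎
      where
      open ≤-Reasoning
      total : ∀ {ω} → ω ∈ filter (¬? ∘ truncated?) nonGaps → ∃[ ω′ ] (ω′ ∈ gaps × Raised ω ω′)
      total {ω} ω∈ with ∈-filter⁻ (¬? ∘ truncated?) {xs = nonGaps} ω∈
      ... | ω∈nonGaps , ¬trunc with ∈-filter⁻ (¬? ∘ gap?) {xs = elements outcomes₁} ω∈nonGaps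
      ... | _ , ¬gap with argmin (arrival ω)
      ... | v , v-min =
        ω [ v ]≔ raise (lookup ω v)
        , ∈-filter⁺ gap? (complete outcomes₁ _) (v , raised-gap r)
        , ¬gap , v , r
        where
        r : RaisedAt v ω (ω [ v ]≔ raise (lookup ω v))
        r = v-min , ≰⇒> (λ le → ¬trunc (v , le)) , refl

    -- The union bound "some row is all heads with probability at most n / 2^L" in counting form.
    -- Overwriting such a row by an arbitrary row `b` loses nothing once its node is recorded: the
    -- old row is known, and `b` can be read off.
    truncated-bound : List.length (filter truncated? nonGaps) * 2 ^ L ≤ n * size outcomes₁
    truncated-bound = begin
      List.length truncs * 2 ^ L      ≡⟨ cong (List.length truncs *_) (size-vectors bools L) ⟨
      List.length truncs * size coinRows ≡⟨ length-cartesianProductWith _,_ truncs (elements coinRows) ⟨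
      List.length (cartesianProduct truncs (elements coinRows)) ≤⟨
        pigeonhole Resample
          (cartesianProduct⁺ (filter⁺ truncated? (filter⁺ (¬? ∘ gap?) (unique outcomes₁)))
                             (unique coinRows))
          total injective ⟩
      List.length (cartesianProduct (allFin n) (elements outcomes₁))
        ≡⟨ length-cartesianProductWith _,_ (allFin n) (elements outcomes₁) ⟩
      List.length (allFin n) * size outcomes₁
        ≡⟨ cong (_* size outcomes₁) (Listₚ.length-tabulate {n = n} id) ⟩
      n * size outcomes₁ ∎
      where
      open ≤-Reasoning
      truncs : List Ω
      truncs = filter truncated? nonGaps
      Resample : Ω × Vec Bool L → Fin n × Ω → Set
      Resample (ω , b) (v , ω′) = lookup ω v ≡ Vec.replicate L true × ω′ ≡ ω [ v ]≔ b
      total : ∀ {ωb} → ωb ∈ cartesianProduct truncs (elements coinRows) →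
        ∃[ y ] (y ∈ cartesianProduct (allFin n) (elements outcomes₁) × Resample ωb y)
      total {ω , b} ∈cp with ∈-cartesianProduct⁻ truncs (elements coinRows) ∈cp
      ... | ω∈ , b∈ with ∈-filter⁻ truncated? {xs = nonGaps} ω∈
      ... | _ , v , le = (v , ω [ v ]≔ b)
        , ∈-cartesianProduct⁺ (∈-allFin v) (complete outcomes₁ _)
        , heads≡L _ le , refl
      injective : ∀ {x x′ y} → Resample x y → Resample x′ y → x ≡ x′
      injective {ω , b} {ω₂ , b₂} {v , _} (t , refl) (t₂ , eq) = cong₂ _,_
        (lookup-ext-at v
          (λ c c≢v → trans (sym (Vecₚ.lookup∘update′ c≢v ω b))
             (trans (cong (λ z → lookup z c) eq) (Vecₚ.lookup∘update′ c≢v ω₂ b₂)))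
          (trans t (sym t₂)))
        (trans (sym (Vecₚ.lookup∘update v ω b))
          (trans (cong (λ z → lookup z v) eq) (Vecₚ.lookup∘update v ω₂ b₂)))

    -- The coins make the truncated outcomes at most half of all. Adding the number of non-gaps to
    -- both sides of `nonGaps-split` bounds twice that number by the truncated outcomes plus all
    -- outcomes, that is, by 3/2 of the total.
    nonGaps-bound : n * 2 ≤ 2 ^ L → 4 * List.length nonGaps ≤ 3 * size outcomes₁
    nonGaps-bound 2n≤2^L = arith (List.length nonGaps) (List.length gaps) _ (size outcomes₁)
      nonGaps-split (length-filter-¬ gap? (elements outcomes₁))
      (*-cancelˡ-≤ n (begin
        n * (t * 2)          ≡⟨ swap n t ⟩
        t * (n * 2)          ≤⟨ *-monoʳ-≤ t 2n≤2^L ⟩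
        t * 2 ^ L            ≤⟨ truncated-bound ⟩
        n * size outcomes₁   ∎))
      where
      open ≤-Reasoning
      t = List.length (filter truncated? nonGaps)
      swap : ∀ n t → n * (t * 2) ≡ t * (n * 2)
      swap = solve-∀
      arith : ∀ g̅ g t x → g̅ ≤ t + g → g + g̅ ≡ x → t * 2 ≤ x → 4 * g̅ ≤ 3 * x
      arith g̅ g t _ p refl q = begin
        4 * g̅                     ≡⟨ e₁ g̅ ⟩
        g̅ + g̅ + 2 * g̅             ≤⟨ +-monoˡ-≤ (2 * g̅) (+-mono-≤ p p) ⟩
        t + g + (t + g) + 2 * g̅   ≡⟨ e₂ t g g̅ ⟩
        t * 2 + 2 * (g + g̅)       ≤⟨ +-monoˡ-≤ (2 * (g + g̅)) q ⟩
        (g + g̅) + 2 * (g + g̅)     ∎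
        where
        e₁ : ∀ g → 4 * g ≡ g + g + 2 * g
        e₁ = solve-∀
        e₂ : ∀ t g g̅ → t + g + (t + g) + 2 * g̅ ≡ t * 2 + 2 * (g + g̅)
        e₂ = solve-∀

-- Amplification by independent trials

length-concatMap-≤ : ∀ {A B : Set} (f : A → List B) xs k b →
  (∀ x → List.length (f x) * k ≤ b) → List.length (concatMap f xs) * k ≤ List.length xs * b
length-concatMap-≤ f []       k b f≤ = z≤n
length-concatMap-≤ f (x ∷ xs) k b f≤ = begin
  List.length (f x ++ concatMap f xs) * k                ≡⟨ cong (_* k) (Listₚ.length-++ (f x)) ⟩
  (List.length (f x) + List.length (concatMap f xs)) * k ≡⟨ *-distribʳ-+ k (List.length (f x)) _ ⟩
  List.length (f x) * k + List.length (concatMap f xs) * k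
    ≤⟨ +-mono-≤ (f≤ x) (length-concatMap-≤ f xs k b f≤) ⟩
  b + List.length xs * b                                 ∎
  where open ≤-Reasoning

^-distribʳ-* : ∀ k a b → (a * b) ^ k ≡ a ^ k * b ^ k
^-distribʳ-* zero    a b = refl
^-distribʳ-* (suc k) a b = trans (cong (a * b *_) (^-distribʳ-* k a b)) (swap a b (a ^ k) (b ^ k))
  where
  swap : ∀ a b x y → a * b * (x * y) ≡ a * x * (b * y)
  swap = solve-∀

chunk : ∀ reps L → Vec Bool (reps * L) → Fin reps → Vec Bool L
chunk reps L b = lookup (proj₁ (group reps L b))

chunk-injective : ∀ reps L (b b′ : Vec Bool (reps * L)) →
  (∀ r → chunk reps L b r ≡ chunk reps L b′ r) → b ≡ b′
chunk-injective reps L b b′ eq = trans (proj₂ (group reps L b))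
  (trans (cong Vec.concat (lookup-ext {xs = proj₁ (group reps L b)} {proj₁ (group reps L b′)} eq))
    (sym (proj₂ (group reps L b′))))

trial : ∀ {n} reps L → Vec (Vec Bool (reps * L)) n → Fin reps → Vec (Vec Bool L) n
trial reps L ω r = tabulate λ v → chunk reps L (lookup ω v) r

trial-injective : ∀ {n} reps L (ω ω′ : Vec (Vec Bool (reps * L)) n) →
  tabulate (trial reps L ω) ≡ tabulate (trial reps L ω′) → ω ≡ ω′
trial-injective reps L ω ω′ eq = lookup-ext λ v → chunk-injective reps L _ _ λ r → begin
  chunk reps L (lookup ω v) r                              ≡⟨ lookup-trials ω v r ⟨
  lookup (lookup (tabulate (trial reps L ω)) r) v   ≡⟨ cong (λ ts → lookup (lookup ts r) v) eq ⟩
  lookup (lookup (tabulate (trial reps L ω′)) r) v  ≡⟨ lookup-trials ω′ v r ⟩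
  chunk reps L (lookup ω′ v) r                             ∎
  where
  open ≡-Reasoning
  lookup-trials : ∀ ω v r →
    lookup (lookup (tabulate (trial reps L ω)) r) v ≡ chunk reps L (lookup ω v) r
  lookup-trials ω v r = trans (cong (λ t → lookup t v) (Vecₚ.lookup∘tabulate (trial reps L ω) r))
    (Vecₚ.lookup∘tabulate _ v)

size-outcomes : ∀ n reps L → size (vectors (vectors bools (reps * L)) n) ≡ 2 ^ (n * (reps * L))
size-outcomes n reps L = begin
  size (vectors (vectors bools (reps * L)) n) ≡⟨ size-vectors (vectors bools (reps * L)) n ⟩
  size (vectors bools (reps * L)) ^ n  ≡⟨ cong (_^ n) (size-vectors bools (reps * L)) ⟩
  (2 ^ (reps * L)) ^ n                 ≡⟨ ^-*-assoc 2 (reps * L) n ⟩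
  2 ^ (reps * L * n)                   ≡⟨ cong (2 ^_) (*-comm (reps * L) n) ⟩
  2 ^ (n * (reps * L))                 ∎
  where open ≡-Reasoning

module Amplification
  (n reps L : ℕ)
  {P : Fin n → Vec (Vec Bool L) n → Set} (P? : ∀ u → Decidable (P u))
  (failure≤¾ : ∀ u → 4 * List.length (filter (¬? ∘ P? u) (elements (vectors (vectors bools L) n)))
                     ≤ 3 * size (vectors (vectors bools L) n))
  where

  Good : Vec (Vec Bool (reps * L)) n → Set
  Good ω = ∀ u → ∃[ r ] P u (trial reps L ω r)

  good? : Decidable Good
  good? ω = all? λ u → any? λ r → P? u (trial reps L ω r)

  once : Finite (Vec (Vec Bool L) n)
  once = vectors (vectors bools L) n

  outcomes : Finite (Vec (Vec Bool (reps * L)) n)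
  outcomes = vectors (vectors bools (reps * L)) n

  good bad : List (Vec (Vec Bool (reps * L)) n)
  good = filter good? (elements outcomes)
  bad  = filter (¬? ∘ good?) (elements outcomes)

  good-unique : Unique good
  good-unique = filter⁺ good? (unique outcomes)

  good-Good : All Good good
  good-Good = all-filter good? (elements outcomes)

  failures : Fin n → List (Vec (Vec Bool L) n)
  failures u = filter (¬? ∘ P? u) (elements once)

  size-once^reps : size once ^ reps ≡ 2 ^ (n * (reps * L))
  size-once^reps = begin
    size once ^ reps        ≡⟨ cong (_^ reps) (size-vectors (vectors bools L) n) ⟩
    (size (vectors bools L) ^ n) ^ reps ≡⟨ cong (λ s → (s ^ n) ^ reps) (size-vectors bools L) ⟩
    ((2 ^ L) ^ n) ^ reps    ≡⟨ cong (_^ reps) (^-*-assoc 2 L n) ⟩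
    (2 ^ (L * n)) ^ reps    ≡⟨ ^-*-assoc 2 (L * n) reps ⟩
    2 ^ (L * n * reps)      ≡⟨ cong (2 ^_) (swap L n reps) ⟩
    2 ^ (n * (reps * L))    ∎
    where
    open ≡-Reasoning
    swap : ∀ L n r → L * n * r ≡ n * (r * L)
    swap = solve-∀

  -- Independence in counting form: the tuples of trials that all fail at `u` form a power of the
  -- set of single failures, so the ratio 3/4 is raised to the power `reps`.
  failures-bound : ∀ u → List.length (vecs (failures u) reps) * 4 ^ reps ≤ 3 ^ reps * size outcomes
  failures-bound u = begin
    List.length (vecs (failures u) reps) * 4 ^ reps
      ≡⟨ cong (_* 4 ^ reps) (length-vecs (failures u) reps) ⟩
    List.length (failures u) ^ reps * 4 ^ reps      ≡⟨ *-comm _ (4 ^ reps) ⟩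
    4 ^ reps * List.length (failures u) ^ reps      ≡⟨ ^-distribʳ-* reps 4 _ ⟨
    (4 * List.length (failures u)) ^ reps           ≤⟨ ^-monoˡ-≤ reps (failure≤¾ u) ⟩
    (3 * size once) ^ reps                          ≡⟨ ^-distribʳ-* reps 3 _ ⟩
    3 ^ reps * size once ^ reps
      ≡⟨ cong (3 ^ reps *_) (trans size-once^reps (sym (size-outcomes n reps L))) ⟩
    3 ^ reps * size outcomes                        ∎
    where open ≤-Reasoning

  -- The union bound over nodes: in a bad outcome all trials fail at one common node, and an outcome
  -- is determined by the tuple of its trials.
  bad⊆ : List.length bad ≤ List.length (concatMap (λ u → vecs (failures u) reps) (allFin n))
  bad⊆ = pigeonhole (λ ω ts → ts ≡ tabulate (trial reps L ω))
    (filter⁺ (¬? ∘ good?) (unique outcomes)) total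
    (λ {ω} {ω′} p q → trial-injective reps L ω ω′ (trans (sym p) q))
    where
    total : ∀ {ω} → ω ∈ bad → ∃[ ts ]
      (ts ∈ concatMap (λ u → vecs (failures u) reps) (allFin n) × ts ≡ tabulate (trial reps L ω))
    total {ω} ω∈bad with _ , ¬good ← ∈-filter⁻ (¬? ∘ good?) {xs = elements outcomes} ω∈bad
      with u , ¬any ← ¬∀⟶∃¬ n _ (λ u → any? λ r → P? u (trial reps L ω r)) ¬good
      = _
      , ∈-concatMap⁺ (λ u → vecs (failures u) reps) (Any.map (λ { refl → ts∈ }) (∈-allFin u))
      , refl
      where
      ts∈ : tabulate (trial reps L ω) ∈ vecs (failures u) reps
      ts∈ = ∈-vecs _ λ r → ∈-filter⁺ (¬? ∘ P? u) (complete once _)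
        (λ p → ¬any (r , subst (P u) (Vecₚ.lookup∘tabulate (trial reps L ω) r) p))

  -- It is enough that n^c times the number of bad outcomes is at most the number of all outcomes;
  -- `n (3/4)^reps` bounds the bad fraction, and the hypothesis is that this is at most n^(-c).
  good-probability : ∀ c → n ^ c * (n * 3 ^ reps) ≤ 4 ^ reps →
    n ^ c * 2 ^ (n * (reps * L)) ≤ n ^ c * List.length good + 2 ^ (n * (reps * L))
  good-probability c n^c≤ =
    subst (λ y → n ^ c * y ≤ n ^ c * List.length good + y) (size-outcomes n reps L) (begin
    n ^ c * Y
      ≡⟨ cong (n ^ c *_) (length-filter-¬ good? (elements outcomes)) ⟨
    n ^ c * (List.length good + List.length bad) ≡⟨ *-distribˡ-+ (n ^ c) (List.length good) _ ⟩
    n ^ c * List.length good + n ^ c * List.length bad ≤⟨ +-monoʳ-≤ (n ^ c * List.length good) n^c*bad≤ ⟩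
    n ^ c * List.length good + Y               ∎)
    where
    open ≤-Reasoning
    Y = size outcomes
    instance
      4^≢0 : NonZero (4 ^ reps)
      4^≢0 = m^n≢0 4 reps
    bad*4^ : List.length bad * 4 ^ reps ≤ n * (3 ^ reps * Y)
    bad*4^ = begin
      List.length bad * 4 ^ reps ≤⟨ *-monoˡ-≤ (4 ^ reps) bad⊆ ⟩
      List.length (concatMap (λ u → vecs (failures u) reps) (allFin n)) * 4 ^ reps
        ≤⟨ length-concatMap-≤ (λ u → vecs (failures u) reps) (allFin n) (4 ^ reps) _ failures-bound ⟩
      List.length (allFin n) * (3 ^ reps * Y)
        ≡⟨ cong (_* (3 ^ reps * Y)) (Listₚ.length-tabulate {n = n} id) ⟩
      n * (3 ^ reps * Y) ∎
    n^c*bad≤ : n ^ c * List.length bad ≤ Y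
    n^c*bad≤ = *-cancelʳ-≤ _ _ (4 ^ reps) (begin
      n ^ c * List.length bad * 4 ^ reps   ≡⟨ *-assoc (n ^ c) _ _ ⟩
      n ^ c * (List.length bad * 4 ^ reps) ≤⟨ *-monoʳ-≤ (n ^ c) bad*4^ ⟩
      n ^ c * (n * (3 ^ reps * Y))         ≡⟨ assoc′ (n ^ c) n (3 ^ reps) Y ⟩
      n ^ c * (n * 3 ^ reps) * Y           ≤⟨ *-monoˡ-≤ Y n^c≤ ⟩
      4 ^ reps * Y                         ≡⟨ *-comm (4 ^ reps) Y ⟩
      Y * 4 ^ reps                         ∎)
      where
      assoc′ : ∀ a n b y → a * (n * (b * y)) ≡ a * (n * b) * y
      assoc′ = solve-∀

-- Waves

-- Breaks ties between waves that arrive in the same round; it also finds the node whose name a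
-- message spells.
firstJust : ∀ {n} {A : Set} → (Fin n → Maybe A) → Maybe A
firstJust {n} f = List.head (List.mapMaybe f (allFin n))

firstJust-cong : ∀ {n} {A : Set} {f g : Fin n → Maybe A} → f ≗ g → firstJust f ≡ firstJust g
firstJust-cong {n} f≗g = cong List.head (Listₚ.mapMaybe-cong f≗g (allFin n))

firstJust-sound : ∀ {n} {A : Set} (f : Fin n → Maybe A) {a} →
  firstJust f ≡ just a → ∃[ y ] f y ≡ just a
firstJust-sound {n} f = go (allFin n)
  where
  go : ∀ xs {a} → List.head (List.mapMaybe f xs) ≡ just a → ∃[ y ] f y ≡ just a
  go (x ∷ xs) eq with f x in fx
  ... | nothing = go xs eq
  ... | just _  = x , trans fx eq

firstJust-complete : ∀ {n} {A : Set} (f : Fin n → Maybe A) {y a} →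
  f y ≡ just a → ∃[ a′ ] firstJust f ≡ just a′
firstJust-complete {n} f {y} fy = go (∈-allFin y)
  where
  go : ∀ {xs} → y ∈ xs → ∃[ a′ ] List.head (List.mapMaybe f xs) ≡ just a′
  go (here refl) rewrite fy = _ , refl
  go {x ∷ xs} (there y∈) with f x
  ... | just a  = a , refl
  ... | nothing = go y∈

module _ {n : ℕ} {G : WeightedGraph n} where

  -- The analogue of reverse-append on lists. Reversal and concatenation are both derived from it,
  -- so costs and membership need one induction each.
  joinAtStart : ∀ {u v w} → Walk G u v → Walk G u w → Walk G v w
  joinAtStart nil                  q = q
  joinAtStart (step {u} {z} e p) q = joinAtStart p (step (trans (symmetric G z u) e) q)

  reverse : ∀ {u v} → Walk G u v → Walk G v u
  reverse p = joinAtStart p nil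

  infixr 5 _++ʷ_
  _++ʷ_ : ∀ {u v w} → Walk G u v → Walk G v w → Walk G u w
  p ++ʷ q = joinAtStart (reverse p) q

  start-All : ∀ {P : Fin n → Set} {u v} (p : Walk G u v) → All P (vertices p) → P u
  start-All nil        (pu ∷ _) = pu
  start-All (step _ _) (pu ∷ _) = pu

  joinAtStart-All : ∀ {P : Fin n → Set} {u v w} (p : Walk G u v) (q : Walk G u w) →
    All P (vertices p) → All P (vertices q) → All P (vertices (joinAtStart p q))
  joinAtStart-All nil        q _        qs = qs
  joinAtStart-All (step _ p) q (_ ∷ ps) qs = joinAtStart-All p _ ps (start-All p ps ∷ qs)

module Rounded {n : ℕ} (G : WeightedGraph n) (κ : ℚ → ℕ) where

  cost : ∀ {u v} → Walk G u v → ℕ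
  cost nil                = 0
  cost (step {x = x} _ p) = κ x + cost p

  cost-joinAtStart : ∀ {u v w} (p : Walk G u v) (q : Walk G u w) →
    cost (joinAtStart p q) ≡ cost p + cost q
  cost-joinAtStart nil                q = refl
  cost-joinAtStart (step {x = x} e p) q =
    trans (cost-joinAtStart p _) (shift (cost p) (κ x) (cost q))
    where
    shift : ∀ a b c → a + (b + c) ≡ b + a + c
    shift = solve-∀

  cost-reverse : ∀ {u v} (p : Walk G u v) → cost (reverse p) ≡ cost p
  cost-reverse p = trans (cost-joinAtStart p nil) (+-identityʳ _)

  cost-++ : ∀ {u v w} (p : Walk G u v) (q : Walk G v w) → cost (p ++ʷ q) ≡ cost p + cost q
  cost-++ p q = trans (cost-joinAtStart (reverse p) q) (cong (_+ cost q) (cost-reverse p))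

  -- Places a cheap path inside the ball around its starting node, so that capturing the ball
  -- captures the path.
  walks-to-start : ∀ {u v} (p : Walk G u v) →
    All (λ x → Σ[ q ∈ Walk G x u ] cost q ≤ cost p) (vertices p)
  walks-to-start nil = (nil , z≤n) ∷ []
  walks-to-start {u} (step {z = v} {x = w} e p) = (nil , z≤n) ∷ All.map extend (walks-to-start p)
    where
    extend : ∀ {x} → Σ[ q ∈ Walk G x _ ] cost q ≤ cost p → Σ[ q ∈ Walk G x u ] cost q ≤ κ w + cost p
    extend (q , q≤) = q ++ʷ step (trans (symmetric G _ u) e) nil , (begin
      cost (q ++ʷ step _ nil) ≡⟨ cost-++ q _ ⟩
      cost q + (κ w + 0)      ≡⟨ cong (cost q +_) (+-identityʳ (κ w)) ⟩
      cost q + κ w            ≤⟨ +-monoˡ-≤ (κ w) q≤ ⟩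
      cost p + κ w            ≡⟨ +-comm (cost p) (κ w) ⟩
      κ w + cost p            ∎)
      where open ≤-Reasoning

-- The centre that captured a node, and the time of the capture.
Capture : ℕ → Set
Capture n = Maybe (Fin n × ℕ)

module Local {n : ℕ} (κ : ℚ → ℕ) where

  -- An edge of cost `κ w` is crossed by waiting: the offer is made only in the step that ends at
  -- time `τ + κ w`. The receiver's clock then supplies the arrival time, and the message need carry
  -- no more than the name of the centre.
  offer : (Fin n → Maybe ℚ) → ℕ → Capture n → Fin n → Maybe (Fin n)
  offer row t nothing        y = nothing
  offer row t (just (c , τ)) y =
    maybe′ (λ w → if suc t ≡ᵇ τ + κ w then just c else nothing) nothing (row y)

  wake : Fin n → ℕ → ℕ → Capture n
  wake x s t = if s ≡ᵇ t then just (x , t) else nothing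

  advance : Fin n → ℕ → ℕ → Capture n → (Fin n → Maybe (Fin n)) → Capture n
  advance x s t (just z) f = just z
  advance x s t nothing  f = maybe′ (λ c → just (c , suc t)) (wake x s (suc t)) (firstJust f)

  advance-cong : ∀ x s t z {f g} → f ≗ g → advance x s t z f ≡ advance x s t z g
  advance-cong x s t (just z) eq = refl
  advance-cong x s t nothing  eq = cong (maybe′ _ _) (firstJust-cong eq)

  wake-sound : ∀ x s t {c τ} → wake x s t ≡ just (c , τ) → c ≡ x × s ≡ t × τ ≡ t
  wake-sound x s t eq with s ≡ᵇ t in s≡t
  wake-sound x s t refl | true = refl , ≡ᵇ⇒≡ s t (subst Bool.T (sym s≡t) _) , refl

  wake-complete : ∀ x t → wake x t t ≡ just (x , t)
  wake-complete x t with t ≡ᵇ t | ≡⇒≡ᵇ t t refl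
  ... | true | _ = refl

  offer-sound : ∀ row t z y {c} → offer row t z y ≡ just c →
    ∃[ τ ] ∃[ w ] (z ≡ just (c , τ) × row y ≡ just w × suc t ≡ τ + κ w)
  offer-sound row t (just (c , τ)) y eq with row y in rowy
  ... | just w with suc t ≡ᵇ τ + κ w in t≡
  offer-sound row t (just (c , τ)) y refl | just w | true =
    τ , w , refl , refl , ≡ᵇ⇒≡ (suc t) (τ + κ w) (subst Bool.T (sym t≡) _)

  offer-complete : ∀ row t y {c τ w} → row y ≡ just w → suc t ≡ τ + κ w →
    offer row t (just (c , τ)) y ≡ just c
  offer-complete row t y {c} {τ} {w} rowy t≡ with row y
  offer-complete row t y {c} {τ} {w} refl t≡ | just _ with suc t ≡ᵇ τ + κ w | ≡⇒≡ᵇ (suc t) _ t≡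
  ... | true | _ = refl

module Waves {n : ℕ} (G : WeightedGraph n) (κ : ℚ → ℕ) (κ≥1 : ∀ x → 1 ≤ κ x) (s : Fin n → ℕ) where
  open Local {n} κ
  open Rounded G κ

  capture : ℕ → Fin n → Capture n
  offers : ℕ → Fin n → Fin n → Maybe (Fin n)

  capture zero    x = wake x (s x) 0
  capture (suc t) x = advance x (s x) t (capture t x) (offers t x)

  offers t x y = maybe′ (λ _ → offer (weight G y) t (capture t y) x) nothing (weight G y x)

  capture-suc : ∀ {t x z} → capture t x ≡ just z → capture (suc t) x ≡ just z
  capture-suc {t} {x} eq rewrite eq = refl

  capture-+ : ∀ k {t x z} → capture t x ≡ just z → capture (k + t) x ≡ just z
  capture-+ zero    eq = eq
  capture-+ (suc k) eq = capture-suc {k + _} (capture-+ k eq)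

  capture-mono : ∀ {t t′ x z} → t ≤ t′ → capture t x ≡ just z → capture t′ x ≡ just z
  capture-mono {t} {t′} {x} {z} t≤t′ eq =
    subst (λ k → capture k x ≡ just z) (m∸n+n≡m t≤t′) (capture-+ (t′ ∸ t) eq)

  capture-agree : ∀ {t t′ x z z′} → capture t x ≡ just z → capture t′ x ≡ just z′ → z ≡ z′
  capture-agree {t} {t′} eq eq′ with ≤-total t t′
  ... | inj₁ le = just-injective (trans (sym (capture-mono le eq)) eq′)
  ... | inj₂ le = just-injective (trans (sym eq) (capture-mono le eq′))

  data NewCapture (t : ℕ) (x c : Fin n) : Set where
    woken : c ≡ x → s x ≡ suc t → NewCapture t x c
    taken : ∀ {y τ w} → weight G x y ≡ just w → capture t y ≡ just (c , τ) →
            suc t ≡ τ + κ w → NewCapture t x c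

  offers-sound : ∀ t x y {c} → offers t x y ≡ just c → NewCapture t x c
  offers-sound t x y eq with weight G y x in yx
  ... | just _ with offer-sound (weight G y) t (capture t y) x eq
  ... | τ , w , cap , yx′ , t≡ = taken (trans (symmetric G x y) yx′) cap t≡

  capture-inv : ∀ t x {c τ} → capture (suc t) x ≡ just (c , τ) →
    capture t x ≡ just (c , τ) ⊎ (τ ≡ suc t × NewCapture t x c)
  capture-inv t x eq with capture t x
  ... | just z = inj₁ eq
  ... | nothing with firstJust (offers t x) in first
  capture-inv t x refl | nothing | just c with y , offered ← firstJust-sound (offers t x) first =
    inj₂ (refl , offers-sound t x y offered)
  ... | nothing with refl , woke , τ≡ ← wake-sound x (s x) (suc t) eq = inj₂ (τ≡ , woken refl woke)

  capture-time : ∀ t x {c τ} → capture t x ≡ just (c , τ) → τ ≤ t × capture τ x ≡ just (c , τ)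
  capture-time zero    x eq with refl , s≡0 , refl ← wake-sound x (s x) 0 eq = z≤n , eq
  capture-time (suc t) x eq with capture-inv t x eq
  ... | inj₁ old with τ≤t , cap ← capture-time t x old = m≤n⇒m≤1+n τ≤t , cap
  ... | inj₂ (refl , _) = ≤-refl , eq

  Captured : ℕ → Fin n → Set
  Captured t x = ∃[ z ] capture t x ≡ just z

  captured-awake : ∀ x → Captured (s x) x
  captured-awake x = go (s x) refl
    where
    go : ∀ t → s x ≡ t → Captured t x
    go zero    s≡ rewrite s≡ = _ , refl
    go (suc t) s≡ with capture t x
    ... | just z  = z , refl
    ... | nothing with firstJust (offers t x)
    ... | just c  = _ , refl
    ... | nothing rewrite s≡ = _ , wake-complete x (suc t)

  captured-step : ∀ {x y w c τ} → weight G x y ≡ just w → capture τ y ≡ just (c , τ) →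
    Captured (τ + κ w) x
  captured-step {x} {y} {w} {c} {τ} xy cap with κ w in κw | κ≥1 w
  -- The offer leaves at time `τ + k`, when `y` is already captured. Positive costs are what leave
  -- room for this step.
  ... | suc k | _ rewrite +-suc τ k with capture (τ + k) x
  ... | just z  = z , refl
  ... | nothing with firstJust-complete (offers (τ + k) x) {y} offered
    where
    yx = trans (symmetric G y x) xy
    cap′ : capture (τ + k) y ≡ just (c , τ)
    cap′ = capture-mono (m≤m+n τ k) cap
    offered : offers (τ + k) x y ≡ just c
    offered rewrite yx | cap′ =
      offer-complete (weight G y) (τ + k) x yx
        (trans (sym (+-suc τ k)) (cong (τ +_) (sym κw)))
  ... | c′ , first rewrite first = _ , refl

  -- The wave of `v` may be stopped on the way or never start, when another wave captures a node
  -- first. Whichever wave did so travels on along `p` without delay, so the time bound survives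
  -- although the centre may differ.
  captured-walk : ∀ {x v} (p : Walk G x v) → Captured (s v + cost p) x
  captured-walk {v} nil rewrite +-identityʳ (s v) = captured-awake v
  captured-walk {x} {v} (step {x = w} xy p)
    with (c , τ) , cap ← captured-walk p
    with τ≤ , cap′ ← capture-time _ _ cap
    with z , cap″ ← captured-step xy cap′
    = z , capture-mono (begin
      τ + κ w                ≤⟨ +-monoˡ-≤ (κ w) τ≤ ⟩
      s v + cost p + κ w     ≡⟨ shift (s v) (cost p) (κ w) ⟩
      s v + (κ w + cost p)   ∎) cap″
    where
    open ≤-Reasoning
    shift : ∀ a b c → a + b + c ≡ a + (c + b)
    shift = solve-∀

  capture-early : ∀ {t x v c τ} → capture t x ≡ just (c , τ) → (p : Walk G x v) → τ ≤ s v + cost p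
  capture-early {t} {x} {v} cap p
    with (c′ , τ′) , cap′ ← captured-walk p
    with refl ← capture-agree {t} {s v + cost p} cap cap′
    = proj₁ (capture-time _ _ cap′)

  In : ℕ → Fin n → Fin n → Set
  In t c x = ∃[ τ ] capture t x ≡ just (c , τ)

  -- Each capture is traced back to the neighbour that offered it, which has the same centre; hence
  -- the walk stays inside the cluster. Offers arrive exactly at `τ + κ w`, so the costs add up to
  -- an equality, which the gap argument uses to bound the distance to `c`.
  walk-to-centre : ∀ t x {c τ} → capture t x ≡ just (c , τ) →
    Σ[ p ∈ Walk G x c ] (s c + cost p ≡ τ × All (In t c) (vertices p))
  walk-to-centre zero x eq with refl , s≡0 , refl ← wake-sound x (s x) 0 eq =
    nil , trans (+-identityʳ _) s≡0 , (_ , eq) ∷ []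
  walk-to-centre (suc t) x eq with capture-inv t x eq
  ... | inj₁ old with p , len , ins ← walk-to-centre t x old =
    p , len , All.map (λ { (τ , cap) → τ , capture-suc {t} cap }) ins
  ... | inj₂ (refl , woken refl woke) = nil , trans (+-identityʳ _) woke , (_ , eq) ∷ []
  ... | inj₂ (refl , taken {y} {τ} {w} xy cap t≡) with p , len , ins ← walk-to-centre t y cap =
    step xy p , trans (shift (s _) (κ w) (cost p)) (trans (cong (_+ κ w) len) (sym t≡))
    , (_ , eq) ∷ All.map (λ { (τ , cap) → τ , capture-suc {t} cap }) ins
    where
    shift : ∀ a b c → a + (b + c) ≡ a + c + b
    shift = solve-∀

  centre-walk : ∀ {t c x} → In t c x →
    Σ[ p ∈ Walk G x c ] (All (In t c) (vertices p) × cost p ≤ t)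
  centre-walk {t} {c} {x} (τ , cap) =
    let p , len , ins = walk-to-centre t x cap
    in p , ins , ≤-trans (m≤n+m (cost p) (s c)) (≤-trans (≤-reflexive len) (proj₁ (capture-time t x cap)))

-- Distances and captured balls

module Distance {n : ℕ} (G : WeightedGraph n) (κ : ℚ → ℕ) (κ≥1 : ∀ x → 1 ≤ κ x) (T : ℕ) where
  open Rounded G κ

  -- A run of waves needs a start time at every node. With `T` for all nodes but `u`, every node is
  -- captured by time `T`, and a capture before `T` can only stem from `u`.
  source : Fin n → Fin n → ℕ
  source u c = if does (c ≟ᶠ u) then 0 else T

  source-refl : ∀ u → source u u ≡ 0
  source-refl u with u ≟ᶠ u
  ... | yes _  = refl
  ... | no u≢u = contradiction refl u≢u

  source-≢ : ∀ {u c} → c ≢ u → source u c ≡ T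
  source-≢ {u} {c} c≢u with c ≟ᶠ u
  ... | yes c≡u = contradiction c≡u c≢u
  ... | no _    = refl

  source≤T : ∀ u c → source u c ≤ T
  source≤T u c with c ≟ᶠ u
  ... | yes _ = z≤n
  ... | no _  = ≤-refl

  module From (u : Fin n) = Waves G κ κ≥1 (source u)

  -- The distance to u, capped at T, read off from a wave that starts at u alone.
  dist : Fin n → Fin n → ℕ
  dist u c = maybe′ proj₂ T (From.capture u T c)

  dist-captured : ∀ u c → ∃[ c′ ] From.capture u T c ≡ just (c′ , dist u c)
  dist-captured u c
    with (c′ , τ) , cap ← From.captured-awake u c
    with cap′ ← From.capture-mono u (source≤T u c) cap
    = c′ , trans cap′ (cong (λ t → just (c′ , t)) (sym (cong (maybe′ proj₂ T) cap′)))

  dist≤cost : ∀ {u c} (p : Walk G c u) → dist u c ≤ cost p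
  dist≤cost {u} {c} p with c′ , cap ← dist-captured u c =
    subst (λ t → dist u c ≤ t + cost p) (source-refl u) (From.capture-early u {T} cap p)

  dist-walk : ∀ {u c} → dist u c < T → Σ[ p ∈ Walk G c u ] cost p ≡ dist u c
  dist-walk {u} {c} d<T
    with c′ , cap ← dist-captured u c
    with p , len , _ ← From.walk-to-centre u T c cap
    = to-source p len (c′ ≟ᶠ u)
    where
    to-source : ∀ {c′} (p : Walk G c c′) → source u c′ + cost p ≡ dist u c → Dec (c′ ≡ u) →
      Σ[ p ∈ Walk G c u ] cost p ≡ dist u c
    to-source p len (yes refl) = p , trans (cong (_+ cost p) (sym (source-refl u))) len
    to-source p len (no c′≢u)  = contradiction
      (subst (T ≤_) len (subst (λ t → T ≤ t + cost p) (sym (source-≢ c′≢u)) (m≤m+n T (cost p))))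
      (<⇒≱ d<T)

  module _ (s : Fin n → ℕ) (s≤T : ∀ v → s v ≤ T) where
    open Waves G κ κ≥1 s

    captured-by-T : ∀ x → Captured T x
    captured-by-T x = _ , capture-mono (s≤T x) (proj₂ (captured-awake x))

    -- Some wave reaches `x` by time `s v + dist u v + R`, going from `v` through `u`. If the wave
    -- that captures `x` belonged to `c`, continuing from `x` to `u` would bound `s c + dist u c` by
    -- that time plus another `R`, against the gap.
    gap⇒ball-captured : ∀ {R u v} →
      (∀ c → c ≢ v → s v + dist u v + (R + R) < s c + dist u c) →
      ∀ {x} (q : Walk G x u) → cost q ≤ R → In T v x
    gap⇒ball-captured {R} {u} {v} gap {x} q q≤R
      with (c , τ) , cap ← captured-by-T x
      with c ≟ᶠ v
    ... | yes refl = τ , cap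
    ... | no c≢v   = contradiction (gap c c≢v) (≤⇒≯ late)
      where
      open ≤-Reasoning
      walk-v-u : Σ[ w ∈ Walk G v u ] cost w ≤ dist u v
      walk-v-u with v ≟ᶠ u
      ... | yes refl = nil , z≤n
      -- A capped distance need not come from a walk. The gap against the wave of `u` itself, which
      -- starts by time `T` at distance 0, shows that `dist u v` lies below the cap.
      ... | no v≢u with w , len ← dist-walk {u} {v} (begin-strict
        dist u v                    ≤⟨ m≤n+m (dist u v) (s v) ⟩
        s v + dist u v              ≤⟨ m≤m+n _ (R + R) ⟩
        s v + dist u v + (R + R)    <⟨ gap u (v≢u ∘ sym) ⟩
        s u + dist u u              ≤⟨ +-monoʳ-≤ (s u) (dist≤cost {u} nil) ⟩
        s u + 0                     ≡⟨ +-identityʳ (s u) ⟩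
        s u                         ≤⟨ s≤T u ⟩
        T                           ∎) = w , ≤-reflexive len
      τ≤ : τ ≤ s v + (R + dist u v)
      τ≤ with w , w≤ ← walk-v-u = begin
        τ                              ≤⟨ capture-early {T} cap (q ++ʷ reverse w) ⟩
        s v + cost (q ++ʷ reverse w)   ≡⟨ cong (s v +_) (cost-++ q (reverse w)) ⟩
        s v + (cost q + cost (reverse w)) ≡⟨ cong (λ k → s v + (cost q + k)) (cost-reverse w) ⟩
        s v + (cost q + cost w)        ≤⟨ +-monoʳ-≤ (s v) (+-mono-≤ q≤R w≤) ⟩
        s v + (R + dist u v)           ∎
      late : s c + dist u c ≤ s v + dist u v + (R + R)
      late with r , len , _ ← walk-to-centre T x cap = begin
        s c + dist u c                 ≤⟨ +-monoʳ-≤ (s c) (dist≤cost (joinAtStart r q)) ⟩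
        s c + cost (joinAtStart r q)   ≡⟨ cong (s c +_) (cost-joinAtStart r q) ⟩
        s c + (cost r + cost q)        ≡⟨ +-assoc (s c) _ _ ⟨
        s c + cost r + cost q          ≡⟨ cong (_+ cost q) len ⟩
        τ + cost q                     ≤⟨ +-mono-≤ τ≤ q≤R ⟩
        s v + (R + dist u v) + R       ≡⟨ shuffle (s v) R (dist u v) ⟩
        s v + dist u v + (R + R)       ∎
        where
        shuffle : ∀ s R d → s + (R + d) + R ≡ s + d + (R + R)
        shuffle = solve-∀

-- Rounding the weights

-- For a variable `k`, `fromℕ k` is stuck on the normalization of a fraction. This exposes its
-- numerator and denominator to the order on ℚ.
fromℕ-mkℚ : ∀ k → fromℕ k ≡ mkℚ (ℤ.+ k) 0 (Coprimality.sym (Coprimality.1-coprimeTo k))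
fromℕ-mkℚ k = ℚₚ.normalize-coprime {k} {0} _

fromℕ-+ : ∀ a b → fromℕ (a + b) ≡ fromℕ a ℚ.+ fromℕ b
fromℕ-+ a b rewrite fromℕ-mkℚ a | fromℕ-mkℚ b =
  cong (ℚ._/ 1) (sym (cong₂ ℤ._+_ (ℤₚ.*-identityʳ (ℤ.+ a)) (ℤₚ.*-identityʳ (ℤ.+ b))))

fromℕ-* : ∀ a b → fromℕ (a * b) ≡ fromℕ a ℚ.* fromℕ b
fromℕ-* a b rewrite fromℕ-mkℚ a | fromℕ-mkℚ b = cong (ℚ._/ 1) (ℤₚ.pos-* a b)

fromℕ-mono-≤ : ∀ {a b} → a ≤ b → fromℕ a ℚ.≤ fromℕ b
fromℕ-mono-≤ {a} {b} a≤b rewrite fromℕ-mkℚ a | fromℕ-mkℚ b =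
  *≤* (ℤₚ.*-monoʳ-≤-nonNeg (ℤ.+ 1) (ℤ.+≤+ a≤b))

fromℕ-cancel-≤ : ∀ {a b} → fromℕ a ℚ.≤ fromℕ b → a ≤ b
fromℕ-cancel-≤ {a} {b} le rewrite fromℕ-mkℚ a | fromℕ-mkℚ b =
  ℤₚ.drop‿+≤+ (ℤₚ.*-cancelʳ-≤-pos (ℤ.+ a) (ℤ.+ b) (ℤ.+ 1) (ℚₚ.drop-*≤* le))

fromℕ-nonNegative : ∀ k → ℚ.NonNegative (fromℕ k)
fromℕ-nonNegative k = ℚ.nonNegative (fromℕ-mono-≤ {0} {k} z≤n)

⌊_⌋ℕ : ℚ → ℕ
⌊ q ⌋ℕ = ℤ.∣ ↥ q ∣ / ↧ₙ q

⌊⌋ℕ-lower : ∀ q → .{{ℚ.NonNegative q}} → fromℕ ⌊ q ⌋ℕ ℚ.≤ q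
⌊⌋ℕ-lower q@(mkℚ (ℤ.+ a) d _) rewrite fromℕ-mkℚ ⌊ q ⌋ℕ = *≤* (begin
  ℤ.+ (a / suc d) ℤ.* ℤ.+ suc d ≡⟨ ℤₚ.pos-* (a / suc d) (suc d) ⟨
  ℤ.+ (a / suc d * suc d)     ≤⟨ ℤ.+≤+ (DivMod.m/n*n≤m a (suc d)) ⟩
  ℤ.+ a                       ≡⟨ ℤₚ.*-identityʳ (ℤ.+ a) ⟨
  ℤ.+ a ℤ.* ℤ.+ 1               ∎)
  where open ℤₚ.≤-Reasoning

⌊⌋ℕ-upper : ∀ q → .{{ℚ.NonNegative q}} → q ℚ.≤ fromℕ (suc ⌊ q ⌋ℕ)
⌊⌋ℕ-upper q@(mkℚ (ℤ.+ a) d _) rewrite fromℕ-mkℚ (suc ⌊ q ⌋ℕ) = *≤* (begin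
  ℤ.+ a ℤ.* ℤ.+ 1                   ≡⟨ ℤₚ.*-identityʳ (ℤ.+ a) ⟩
  ℤ.+ a                           ≤⟨ ℤ.+≤+ a≤ ⟩
  ℤ.+ (suc (a / suc d) * suc d)   ≡⟨ ℤₚ.pos-* (suc (a / suc d)) (suc d) ⟩
  ℤ.+ suc (a / suc d) ℤ.* ℤ.+ suc d ∎)
  where
  open ℤₚ.≤-Reasoning
  a≤ : a ≤ suc (a / suc d) * suc d
  a≤ = ≤-trans (≤-reflexive (DivMod.m≡m%n+[m/n]*n a (suc d)))
    (+-monoˡ-≤ (a / suc d * suc d) (<⇒≤ (DivMod.m%n<n a (suc d))))

-- An algorithm family has a program for every rational `W`, so the inverse must be total; 0 is a
-- default value.
inverse : ℚ → ℚ
inverse W with W ℚ.≟ 0ℚ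
... | yes _   = 0ℚ
... | no W≢0  = (ℚ.1/ W) {{ℚ.≢-nonZero W≢0}}

inverse-*ˡ : ∀ W → .{{ℚ.Positive W}} → inverse W ℚ.* W ≡ 1ℚ
inverse-*ˡ W with W ℚ.≟ 0ℚ
... | yes refl = contradiction (ℚₚ.positive⁻¹ W) (ℚₚ.<-irrefl refl)
... | no W≢0   = ℚₚ.*-inverseˡ W {{ℚ.≢-nonZero W≢0}}

inverse-nonNegative : ∀ W → .{{ℚ.Positive W}} → ℚ.NonNegative (inverse W)
inverse-nonNegative W with W ℚ.≟ 0ℚ
... | yes _  = _
... | no W≢0 = ℚₚ.pos⇒nonNeg ((ℚ.1/ W) {{ℚ.≢-nonZero W≢0}}) {{ℚₚ.1/pos⇒pos W}}

-- The weight in units of W / ℓ; rounding up even integers keeps every cost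
-- positive.
rounded : ℕ → ℚ → ℚ → ℕ
rounded ℓ W x = suc ⌊ x ℚ.* fromℕ ℓ ℚ.* inverse W ⌋ℕ

rounded≥1 : ∀ ℓ W x → 1 ≤ rounded ℓ W x
rounded≥1 ℓ W x = s≤s z≤n

module _ {n : ℕ} (G : WeightedGraph n) (ℓ : ℕ) (W : ℚ) (0<W : 0ℚ ℚ.< W) where
  open Rounded G (rounded ℓ W)

  private
    instance
      W>0 : ℚ.Positive W
      W>0 = ℚ.positive 0<W
      W≥0 : ℚ.NonNegative W
      W≥0 = ℚₚ.pos⇒nonNeg W
      W⁻¹≥0 : ℚ.NonNegative (inverse W)
      W⁻¹≥0 = inverse-nonNegative W
      ℓ≥0 : ℚ.NonNegative (fromℕ ℓ)
      ℓ≥0 = fromℕ-nonNegative ℓ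

    open ℚₚ.≤-Reasoning

    ratio-*W : ∀ x → x ℚ.* fromℕ ℓ ℚ.* inverse W ℚ.* W ≡ x ℚ.* fromℕ ℓ
    ratio-*W x = trans (ℚₚ.*-assoc (x ℚ.* fromℕ ℓ) (inverse W) W)
      (trans (cong (x ℚ.* fromℕ ℓ ℚ.*_) (inverse-*ˡ W)) (ℚₚ.*-identityʳ (x ℚ.* fromℕ ℓ)))

    ratio≥0 : ∀ {x} → 1ℚ ℚ.≤ x → ℚ.NonNegative (x ℚ.* fromℕ ℓ ℚ.* inverse W)
    ratio≥0 {x} 1≤x = ℚₚ.nonNeg*nonNeg⇒nonNeg (x ℚ.* fromℕ ℓ)
      {{ℚₚ.nonNeg*nonNeg⇒nonNeg x {{ℚ.nonNegative (ℚₚ.≤-trans (ℚₚ.nonNegative⁻¹ 1ℚ) 1≤x)}} (fromℕ ℓ)}}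
      (inverse W)

  rounded-lower : ∀ {x} → 1ℚ ℚ.≤ x → x ℚ.* fromℕ ℓ ℚ.≤ fromℕ (rounded ℓ W x) ℚ.* W
  rounded-lower {x} 1≤x = begin
    x ℚ.* fromℕ ℓ                           ≡⟨ ratio-*W x ⟨
    x ℚ.* fromℕ ℓ ℚ.* inverse W ℚ.* W
      ≤⟨ ℚₚ.*-monoʳ-≤-nonNeg W (⌊⌋ℕ-upper (x ℚ.* fromℕ ℓ ℚ.* inverse W) {{ratio≥0 1≤x}}) ⟩
    fromℕ (rounded ℓ W x) ℚ.* W             ∎

  rounded-upper : ∀ {x} → 1ℚ ℚ.≤ x → fromℕ (rounded ℓ W x) ℚ.* W ℚ.≤ x ℚ.* fromℕ ℓ ℚ.+ W
  rounded-upper {x} 1≤x = begin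
    fromℕ (1 + ⌊ q ⌋ℕ) ℚ.* W            ≡⟨ cong (ℚ._* W) (fromℕ-+ 1 ⌊ q ⌋ℕ) ⟩
    (1ℚ ℚ.+ fromℕ ⌊ q ⌋ℕ) ℚ.* W
      ≤⟨ ℚₚ.*-monoʳ-≤-nonNeg W (ℚₚ.+-monoʳ-≤ 1ℚ (⌊⌋ℕ-lower q {{ratio≥0 1≤x}})) ⟩
    (1ℚ ℚ.+ q) ℚ.* W                    ≡⟨ solve 2 (λ q W → (con 1ℚ :+ q) :* W := q :* W :+ W) refl q W ⟩
    q ℚ.* W ℚ.+ W                       ≡⟨ cong (ℚ._+ W) (ratio-*W x) ⟩
    x ℚ.* fromℕ ℓ ℚ.+ W                 ∎
    where
    open +-*-Solver
    q = x ℚ.* fromℕ ℓ ℚ.* inverse W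

  length≤cost : ∀ {u v} (p : Walk G u v) → length p ℚ.* fromℕ ℓ ℚ.≤ fromℕ (cost p) ℚ.* W
  length≤cost nil = ℚₚ.≤-reflexive (trans (ℚₚ.*-zeroˡ (fromℕ ℓ)) (sym (ℚₚ.*-zeroˡ W)))
  length≤cost (step {u} {v} {x = x} e p) = begin
    (x ℚ.+ length p) ℚ.* fromℕ ℓ                    ≡⟨ ℚₚ.*-distribʳ-+ (fromℕ ℓ) x _ ⟩
    x ℚ.* fromℕ ℓ ℚ.+ length p ℚ.* fromℕ ℓ
      ≤⟨ ℚₚ.+-mono-≤ (rounded-lower (weight≥1 G u v e)) (length≤cost p) ⟩
    fromℕ (rounded ℓ W x) ℚ.* W ℚ.+ fromℕ (cost p) ℚ.* W ≡⟨ ℚₚ.*-distribʳ-+ W (fromℕ (rounded ℓ W x)) _ ⟨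
    (fromℕ (rounded ℓ W x) ℚ.+ fromℕ (cost p)) ℚ.* W ≡⟨ cong (ℚ._* W) (fromℕ-+ (rounded ℓ W x) (cost p)) ⟨
    fromℕ (rounded ℓ W x + cost p) ℚ.* W            ∎

  cost≤length : ∀ {u v} (p : Walk G u v) →
    fromℕ (cost p) ℚ.* W ℚ.≤ length p ℚ.* fromℕ ℓ ℚ.+ fromℕ (hops p) ℚ.* W
  cost≤length nil = ℚₚ.≤-reflexive (trans (ℚₚ.*-zeroˡ W)
    (sym (trans (cong₂ ℚ._+_ (ℚₚ.*-zeroˡ (fromℕ ℓ)) (ℚₚ.*-zeroˡ W)) refl)))
  cost≤length (step {u} {v} {x = x} e p) = begin
    fromℕ (rounded ℓ W x + cost p) ℚ.* W            ≡⟨ cong (ℚ._* W) (fromℕ-+ (rounded ℓ W x) (cost p)) ⟩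
    (fromℕ (rounded ℓ W x) ℚ.+ fromℕ (cost p)) ℚ.* W ≡⟨ ℚₚ.*-distribʳ-+ W (fromℕ (rounded ℓ W x)) _ ⟩
    fromℕ (rounded ℓ W x) ℚ.* W ℚ.+ fromℕ (cost p) ℚ.* W
      ≤⟨ ℚₚ.+-mono-≤ (rounded-upper (weight≥1 G u v e)) (cost≤length p) ⟩
    x ℚ.* fromℕ ℓ ℚ.+ W ℚ.+ (length p ℚ.* fromℕ ℓ ℚ.+ fromℕ (hops p) ℚ.* W)
      ≡⟨ solve 5 (λ x l y h W → x :* l :+ W :+ (y :* l :+ h :* W) := (x :+ y) :* l :+ (con 1ℚ :+ h) :* W) refl
           x (fromℕ ℓ) (length p) (fromℕ (hops p)) W ⟩
    (x ℚ.+ length p) ℚ.* fromℕ ℓ ℚ.+ (1ℚ ℚ.+ fromℕ (hops p)) ℚ.* W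
      ≡⟨ cong (λ h → (x ℚ.+ length p) ℚ.* fromℕ ℓ ℚ.+ h ℚ.* W) (fromℕ-+ 1 (hops p)) ⟨
    (x ℚ.+ length p) ℚ.* fromℕ ℓ ℚ.+ fromℕ (suc (hops p)) ℚ.* W ∎
    where open +-*-Solver

  -- Length 2W is worth 2ℓ units, and rounding adds at most one unit for each of at most ℓ hops.
  short⇒cheap : ∀ {u v} (p : Walk G u v) → hops p ≤ ℓ → length p ℚ.≤ fromℕ 2 ℚ.* W → cost p ≤ 3 * ℓ
  short⇒cheap p hops≤ℓ length≤2W = fromℕ-cancel-≤ (ℚₚ.*-cancelʳ-≤-pos W (begin
    fromℕ (cost p) ℚ.* W                               ≤⟨ cost≤length p ⟩
    length p ℚ.* fromℕ ℓ ℚ.+ fromℕ (hops p) ℚ.* W      ≤⟨ ℚₚ.+-mono-≤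
        (ℚₚ.*-monoʳ-≤-nonNeg (fromℕ ℓ) length≤2W) (ℚₚ.*-monoʳ-≤-nonNeg W (fromℕ-mono-≤ hops≤ℓ)) ⟩
    fromℕ 2 ℚ.* W ℚ.* fromℕ ℓ ℚ.+ fromℕ ℓ ℚ.* W
      ≡⟨ solve 2 (λ W l → con (fromℕ 2) :* W :* l :+ l :* W := con (fromℕ 3) :* l :* W) refl
           W (fromℕ ℓ) ⟩
    fromℕ 3 ℚ.* fromℕ ℓ ℚ.* W                          ≡⟨ cong (ℚ._* W) (fromℕ-* 3 ℓ) ⟨
    fromℕ (3 * ℓ) ℚ.* W                                ∎))
    where open +-*-Solver

-- For positive ℓ the factor ℓ cancels from `length≤cost`. For ℓ = 0 it cannot be cancelled, but
-- then the budget is 0 and every edge costs at least 1, so only the trivial walk remains.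
cheap⇒short : ∀ {n} (G : WeightedGraph n) ℓ W (0<W : 0ℚ ℚ.< W) k →
  let open Rounded G (rounded ℓ W) in
  ∀ {u v} (p : Walk G u v) → cost p ≤ k * ℓ → length p ℚ.≤ fromℕ k ℚ.* W
cheap⇒short G zero W 0<W k nil cost≤ =
  ℚₚ.nonNegative⁻¹ _ {{ℚₚ.nonNeg*nonNeg⇒nonNeg (fromℕ k) {{fromℕ-nonNegative k}}
    W {{ℚ.nonNegative (ℚₚ.<⇒≤ 0<W)}}}}
cheap⇒short G zero W 0<W k (step e p) cost≤
  with () ← subst (Rounded.cost G (rounded zero W) (step e p) ≤_) (*-zeroʳ k) cost≤
cheap⇒short G ℓ@(suc ℓ-1) W 0<W k p cost≤ = ℚₚ.*-cancelʳ-≤-pos (fromℕ ℓ) {{ℓ>0}} (begin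
  length p ℚ.* fromℕ ℓ         ≤⟨ length≤cost G ℓ W 0<W p ⟩
  fromℕ (Rounded.cost G (rounded ℓ W) p) ℚ.* W
    ≤⟨ ℚₚ.*-monoʳ-≤-nonNeg W {{ℚ.nonNegative (ℚₚ.<⇒≤ 0<W)}} (fromℕ-mono-≤ cost≤) ⟩
  fromℕ (k * ℓ) ℚ.* W          ≡⟨ cong (ℚ._* W) (fromℕ-* k ℓ) ⟩
  fromℕ k ℚ.* fromℕ ℓ ℚ.* W
    ≡⟨ solve 3 (λ k l W → k :* l :* W := k :* W :* l) refl (fromℕ k) (fromℕ ℓ) W ⟩
  fromℕ k ℚ.* W ℚ.* fromℕ ℓ    ∎)
  where
  open ℚₚ.≤-Reasoning
  open +-*-Solver
  ℓ>0 : ℚ.Positive (fromℕ ℓ)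
  ℓ>0 = subst ℚ.Positive (sym (fromℕ-mkℚ ℓ)) _

-- The distributed program

n≤2^⌈log₂n⌉ : ∀ n → n ≤ 2 ^ ⌈log₂ n ⌉
n≤2^⌈log₂n⌉ n = go ⌈log₂ n ⌉ n refl
  where
  go : ∀ k n → ⌈log₂ n ⌉ ≡ k → n ≤ 2 ^ k
  go zero    0             _  = z≤n
  go zero    1             _  = s≤s z≤n
  go zero    (suc (suc n)) eq =
    contradiction (subst (1 ≤_) eq (⌈log₂⌉-mono-≤ {2} {suc (suc n)} (s≤s (s≤s z≤n)))) (λ ())
  go (suc k) n             eq = begin
    n                           ≡⟨ ⌊n/2⌋+⌈n/2⌉≡n n ⟨
    ⌊ n /2⌋ + ⌈ n /2⌉           ≤⟨ +-monoˡ-≤ ⌈ n /2⌉ (⌊n/2⌋≤⌈n/2⌉ n) ⟩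
    ⌈ n /2⌉ + ⌈ n /2⌉           ≤⟨ +-mono-≤ half half ⟩
    2 ^ k + 2 ^ k               ≡⟨ cong (2 ^ k +_) (+-identityʳ (2 ^ k)) ⟨
    2 ^ suc k                   ∎
    where
    open ≤-Reasoning
    half : ⌈ n /2⌉ ≤ 2 ^ k
    half = go k ⌈ n /2⌉ (trans (⌈log₂⌈n/2⌉⌉≡⌈log₂n⌉∸1 n) (cong (_∸ 1) eq))

bit : Fin 2 → Bool
bit zero       = false
bit (suc zero) = true

bit-injective : ∀ {i j} → bit i ≡ bit j → i ≡ j
bit-injective {zero}     {zero}     _ = refl
bit-injective {zero}     {suc zero} ()
bit-injective {suc zero} {zero}     ()
bit-injective {suc zero} {suc zero} _ = refl

binary : ∀ b → Fin (2 ^ b) → Vec Bool b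
binary zero    i = []
binary (suc b) i = bit (proj₁ (remQuot {2} (2 ^ b) i)) ∷ binary b (proj₂ (remQuot {2} (2 ^ b) i))

binary-injective : ∀ b {i j} → binary b i ≡ binary b j → i ≡ j
binary-injective zero    {zero} {zero} _ = refl
binary-injective (suc b) {i} {j} eq with q≡ , r≡ ← Vecₚ.∷-injective eq = begin
  i                                       ≡⟨ combine-remQuot {2} (2 ^ b) i ⟨
  uncurry combine (remQuot {2} (2 ^ b) i) ≡⟨ cong₂ combine (bit-injective q≡) (binary-injective b r≡) ⟩
  uncurry combine (remQuot {2} (2 ^ b) j) ≡⟨ combine-remQuot {2} (2 ^ b) j ⟩
  j                                       ∎
  where open ≡-Reasoning

module Encoding (n b : ℕ) (n≤2^b : n ≤ 2 ^ b) where

  name : Fin n → Vec Bool b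
  name c = binary b (inject≤ c n≤2^b)

  name-injective : ∀ {c c′} → Vec.toList (name c) ≡ Vec.toList (name c′) → c ≡ c′
  name-injective {c} {c′} eq =
    inject≤-injective n≤2^b n≤2^b c c′ (binary-injective b (trans
      (sym (Vecₚ.cast-is-id refl (name c))) (Vecₚ.toList-injective refl (name c) (name c′) eq)))

  encode : Maybe (Fin n) → Message b
  encode (just c) = Vec≤.fromVec (name c)
  encode nothing  = silence

  readAs : List Bool → Fin n → Maybe (Fin n)
  readAs bits c = if does (Listₚ.≡-dec _≟ᵇ_ bits (Vec.toList (name c))) then just c else nothing

  decode : Message b → Maybe (Fin n)
  decode m = firstJust (readAs (Vec≤.toList m))

  readAs-sound : ∀ bits c {c′} → readAs bits c ≡ just c′ → bits ≡ Vec.toList (name c′)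
  readAs-sound bits c eq with Listₚ.≡-dec _≟ᵇ_ bits (Vec.toList (name c))
  readAs-sound bits c refl | yes eq = eq

  readAs-complete : ∀ c → readAs (Vec.toList (name c)) c ≡ just c
  readAs-complete c with Listₚ.≡-dec _≟ᵇ_ (Vec.toList (name c)) (Vec.toList (name c))
  ... | yes _  = refl
  ... | no neq = contradiction refl neq

  decode-name : ∀ c → decode (encode (just c)) ≡ just c
  decode-name c
    with c′ , found ← firstJust-complete (readAs (Vec.toList (name c))) (readAs-complete c)
    with y , read ← firstJust-sound (readAs (Vec.toList (name c))) found
    with refl ← name-injective {c} {c′} (readAs-sound _ y read)
    = found

  -- One bit keeps every name apart from the empty string; with no bits, the name of a single node
  -- would itself be silence.
  decode-silence : 1 ≤ b → decode silence ≡ nothing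
  decode-silence (s≤s z≤n) with firstJust (readAs []) in found
  ... | nothing = refl
  ... | just c with y , read ← firstJust-sound (readAs []) found with () ← readAs-sound [] y read

  decode-encode : 1 ≤ b → ∀ m → decode (encode m) ≡ m
  decode-encode b≥1 (just c) = decode-name c
  decode-encode b≥1 nothing  = decode-silence b≥1

module _ {m : ℕ} where

  count : Fin m → List (Fin m) → ℕ
  count r xs = List.length (List.filter (r ≟ᶠ_) xs)

  count-++ : ∀ r xs ys → count r (xs ++ ys) ≡ count r xs + count r ys
  count-++ r xs ys = trans (cong List.length (Listₚ.filter-++ (r ≟ᶠ_) xs ys))
    (Listₚ.length-++ (List.filter (r ≟ᶠ_) xs))

  count-allFin : ∀ r → count r (allFin m) ≡ 1
  count-allFin r = ≤-antisym
    (⊆⇒length≤ {ys = r ∷ []} (filter⁺ (r ≟ᶠ_) (allFin⁺ m)) λ x∈ →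
      here (sym (proj₂ (∈-filter⁻ (r ≟ᶠ_) {xs = allFin m} x∈))))
    (⊆⇒length≤ {xs = r ∷ []} ([] ∷ []) λ { (here refl) → ∈-filter⁺ (r ≟ᶠ_) (∈-allFin r) refl })

  -- A message has room for one name, so trials cannot share a round. Alternating them costs a
  -- factor `m`, which is the second logarithm in the number of rounds.
  roundRobin : ℕ → List (Fin m)
  roundRobin zero    = []
  roundRobin (suc T) = allFin m ++ roundRobin T

  length-roundRobin : ∀ T → List.length (roundRobin T) ≡ T * m
  length-roundRobin zero    = refl
  length-roundRobin (suc T) = trans (Listₚ.length-++ (allFin m))
    (cong₂ _+_ (Listₚ.length-tabulate {n = m} id) (length-roundRobin T))

  count-roundRobin : ∀ r T → count r (roundRobin T) ≡ T
  count-roundRobin r zero    = refl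
  count-roundRobin r (suc T) = trans (count-++ r (allFin m) (roundRobin T))
    (cong₂ _+_ (count-allFin r) (count-roundRobin r T))

  setAt : ∀ {A : Set} → Fin m → A → (Fin m → A) → Fin m → A
  setAt r a f r′ = if does (r′ ≟ᶠ r) then a else f r′

lookup-transpose-∷ : ∀ {A : Set} {m n} (xs : Vec A n) (xss : Vec (Vec A n) m) i →
  lookup (transpose (xs ∷ xss)) i ≡ lookup xs i ∷ lookup (transpose xss) i
lookup-transpose-∷ {n = n} xs xss i = trans
  (Vecₚ.lookup-⊛ i (Vec.replicate n _∷_ Vec.⊛ xs) (transpose xss))
  (cong (_$ lookup (transpose xss) i) (trans
    (Vecₚ.lookup-⊛ i (Vec.replicate n _∷_) xs)
    (cong (_$ lookup xs i) (Vecₚ.lookup-replicate i _∷_))))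

lookup-transpose : ∀ {A : Set} {m n} (xss : Vec (Vec A n) m) i j →
  lookup (lookup (transpose xss) i) j ≡ lookup (lookup xss j) i
lookup-transpose (xs ∷ xss) i zero    = cong (λ ys → lookup ys zero) (lookup-transpose-∷ xs xss i)
lookup-transpose (xs ∷ xss) i (suc j) = trans
  (cong (λ ys → lookup ys (suc j)) (lookup-transpose-∷ xs xss i)) (lookup-transpose xss i j)

module Program (n b reps L D T : ℕ) (n≤2^b : n ≤ 2 ^ b) (κ : ℚ → ℕ) where
  open Encoding n b n≤2^b
  open Local {n} κ

  record Setup : Set where
    constructor setup
    field
      self  : Fin n
      row   : Fin n → Maybe ℚ
      wakes : Fin reps → ℕ
  open Setup

  -- The trials take turns; the schedule lists the trials of the coming rounds.
  record Memory : Set where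
    constructor memory
    field
      fixed    : Setup
      schedule : List (Fin reps)
      clock    : Fin reps → ℕ
      caught   : Fin reps → Capture n
  open Memory

  transmit : Memory → Fin n → Message b
  transmit st y with schedule st
  ... | []    = silence
  ... | r ∷ _ = encode (offer (row (fixed st)) (clock st r) (caught st r) y)

  update : Memory → (Fin n → Message b) → Memory
  update st inbox with schedule st
  ... | []     = st
  ... | r ∷ rs = memory (fixed st) rs (setAt r (suc (clock st r)) (clock st))
    (setAt r (advance (self (fixed st)) (wakes (fixed st) r) (clock st r) (caught st r) (decode ∘ inbox))
      (caught st))

  isCentre : Fin n → Capture n → Bool
  isCentre c nothing         = false
  isCentre c (just (c′ , _)) = does (c ≟ᶠ c′)

  wakeTime : Vec Bool (reps * L) → Fin reps → ℕ
  wakeTime coins r = launch L D (chunk reps L coins r)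

  program : Algorithm n b
  program .rounds = List.length (roundRobin {reps} T)
  program .coins  = reps * L
  -- A cluster name encodes a pair of a trial and a centre; centres that capture no node give empty
  -- clusters.
  program .labels = reps * n
  program .State  = Memory
  program .init v row coins = memory (setup v row (wakeTime coins)) (roundRobin T) (λ _ → 0)
    (λ r → wake v (wakeTime coins r) 0)
  program .send    = transmit
  program .receive = update
  program .output st = tabulate λ i →
    isCentre (proj₂ (remQuot {reps} n i)) (caught st (proj₁ (remQuot {reps} n i)))

  module Run (b≥1 : 1 ≤ b) (G : WeightedGraph n) (κ≥1 : ∀ x → 1 ≤ κ x)
             (ω : Vec (Vec Bool (reps * L)) n) where

    wakeAt : Fin reps → Fin n → ℕ
    wakeAt r v = wakeTime (lookup ω v) r

    module Trial (r : Fin reps) = Waves G κ κ≥1 (wakeAt r)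

    -- The invariant that ties the program to the ideal waves. `sched` and `clk` are common to all
    -- nodes: sender and receiver work on the same trial at the same time, which is why neither has
    -- to be sent.
    record InSync (sched : List (Fin reps)) (clk : Fin reps → ℕ) (v : Fin n) (st : Memory) : Set where
      field
        fixed≡    : fixed st ≡ setup v (weight G v) (wakeTime (lookup ω v))
        schedule≡ : schedule st ≡ sched
        clock≡    : ∀ r → clock st r ≡ clk r
        caught≡   : ∀ r → caught st r ≡ Trial.capture r (clk r) v
    open InSync

    state : ℕ → Fin n → Memory
    state k = stateAfter program G k ω

    sync-init : ∀ v → InSync (roundRobin T) (λ _ → 0) v (state 0 v)
    sync-init v = record { fixed≡ = refl ; schedule≡ = refl ; clock≡ = λ _ → refl ; caught≡ = λ _ → refl }

    transmit-sync : ∀ {r rs clk v st} → InSync (r ∷ rs) clk v st → ∀ y →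
      decode (transmit st y) ≡ offer (weight G v) (clk r) (Trial.capture r (clk r) v) y
    transmit-sync {r} {st = memory _ _ clock caught}
      record { fixed≡ = refl ; schedule≡ = refl ; clock≡ = c≡ ; caught≡ = g≡ } y
      rewrite c≡ r | g≡ r = decode-encode b≥1 _

    inbox-sync : ∀ {r rs clk k} → (∀ v → InSync (r ∷ rs) clk v (state k v)) → ∀ v y →
      decode (inbox program G (state k) v y) ≡ Trial.offers r (clk r) v y
    inbox-sync sync v y with weight G y v
    ... | nothing = decode-silence b≥1
    ... | just _  = transmit-sync (sync y) v

    update-sync : ∀ {r rs clk v st box} → InSync (r ∷ rs) clk v st →
      (∀ y → decode (box y) ≡ Trial.offers r (clk r) v y) →
      InSync rs (setAt r (suc (clk r)) clk) v (update st box)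
    update-sync {r} {rs} {clk} {v} {memory _ _ clock caught} {box}
      record { fixed≡ = refl ; schedule≡ = refl ; clock≡ = c≡ ; caught≡ = g≡ } box≡ = record
      { fixed≡ = refl ; schedule≡ = refl ; clock≡ = clocks ; caught≡ = caughts }
      where
      clocks : ∀ r′ → setAt r (suc (clock r)) clock r′ ≡ setAt r (suc (clk r)) clk r′
      clocks r′ with does (r′ ≟ᶠ r)
      ... | true  = cong suc (c≡ r)
      ... | false = c≡ r′
      caughts : ∀ r′ →
        setAt r (advance v (wakeAt r v) (clock r) (caught r) (decode ∘ box)) caught r′
          ≡ Trial.capture r′ (setAt r (suc (clk r)) clk r′) v
      caughts r′ with r′ ≟ᶠ r
      ... | no _     = g≡ r′
      ... | yes refl rewrite c≡ r | g≡ r =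
        advance-cong v (wakeAt r v) (clk r) (Trial.capture r (clk r) v) box≡

    run-sync : ∀ sched {clk k} → (∀ v → InSync sched clk v (state k v)) →
      ∃[ clk′ ] ((∀ r → clk′ r ≡ count r sched + clk r)
        × (∀ v → InSync [] clk′ v (state (List.length sched + k) v)))
    run-sync []       {clk} sync = clk , (λ _ → refl) , sync
    run-sync (r ∷ rs) {clk} {k} sync
      with clk′ , clk′≡ , sync′ ← run-sync rs {k = suc k}
        (λ v → update-sync (sync v) (inbox-sync {k = k} sync v))
      = clk′ , (λ r′ → trans (clk′≡ r′) (counts r′))
      , λ v → subst (λ j → InSync [] clk′ v (state j v)) (+-suc (List.length rs) k) (sync′ v)
      where
      counts : ∀ r′ → count r′ rs + setAt r (suc (clk r)) clk r′ ≡ count r′ (r ∷ rs) + clk r′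
      counts r′ with r′ ≟ᶠ r
      ... | yes refl = +-suc (count r rs) (clk r)
      ... | no _     = refl

    final-sync : ∀ v r → caught (state (rounds program) v) r ≡ Trial.capture r T v
    final-sync v r with clk , clk≡ , sync ← run-sync (roundRobin T) sync-init = begin
      caught (state (rounds program) v) r
        ≡⟨ cong (λ j → caught (state j v) r) (+-identityʳ (rounds program)) ⟨
      caught (state (rounds program + 0) v) r ≡⟨ caught≡ (sync v) r ⟩
      Trial.capture r (clk r) v
        ≡⟨ cong (λ t → Trial.capture r t v)
             (trans (clk≡ r) (trans (+-identityʳ _) (count-roundRobin r T))) ⟩
      Trial.capture r T v                     ∎
      where open ≡-Reasoning

-- The clusters form a cover

any-lookup : ∀ {A : Set} {P : A → Set} {N} (xs : Vec A N) i → P (lookup xs i) → VecAny.Any P xs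
any-lookup (x ∷ xs) zero    p = VecAny.here p
any-lookup (x ∷ xs) (suc i) p = VecAny.there (any-lookup xs i p)

members : ∀ {n} → Subset n → List (Fin n)
members []          = []
members (true ∷ C)  = zero ∷ List.map suc (members C)
members (false ∷ C) = List.map suc (members C)

length-members : ∀ {n} (C : Subset n) → List.length (members C) ≡ ∣ C ∣
length-members []          = refl
length-members (true ∷ C)  = cong suc (trans (Listₚ.length-map suc (members C)) (length-members C))
length-members (false ∷ C) = trans (Listₚ.length-map suc (members C)) (length-members C)

members-sound : ∀ {n} (C : Subset n) {x} → x ∈ members C → x ∈ˢ C
members-sound (true ∷ C)  (here refl) = Vec.here
members-sound (true ∷ C)  (there x∈) with _ , y∈ , refl ← ∈-map⁻ suc x∈ = Vec.there (members-sound C y∈)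
members-sound (false ∷ C) x∈         with _ , y∈ , refl ← ∈-map⁻ suc x∈ = Vec.there (members-sound C y∈)

members-unique : ∀ {n} (C : Subset n) → Unique (members C)
members-unique []          = []
members-unique (true ∷ C)  =
  All.tabulate (λ x∈ 0≡x → zero∉ (subst (_∈ _) (sym 0≡x) x∈)) ∷ map⁺ suc-injectiveᶠ (members-unique C)
  where
  zero∉ : ¬ (zero ∈ List.map suc (members C))
  zero∉ 0∈ with _ , _ , () ← ∈-map⁻ suc 0∈
members-unique (false ∷ C) = map⁺ suc-injectiveᶠ (members-unique C)

module _ {A X : Set} (list : A → List X) (list-unique : ∀ a → Unique (list a)) where

  incidences : ∀ {N} → Vec A N → List (Fin N × X)
  incidences []       = []
  incidences (a ∷ as) = List.map (zero ,_) (list a) ++ List.map (map₁ suc) (incidences as)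

  length-incidences : ∀ {N} (as : Vec A N) →
    List.length (incidences as) ≡ Vec.sum (Vec.map (List.length ∘ list) as)
  length-incidences []       = refl
  length-incidences (a ∷ as) = trans (Listₚ.length-++ (List.map (zero ,_) (list a)))
    (cong₂ _+_ (Listₚ.length-map (zero ,_) (list a))
      (trans (Listₚ.length-map (map₁ suc) (incidences as)) (length-incidences as)))

  incidences-sound : ∀ {N} (as : Vec A N) {i x} → (i , x) ∈ incidences as → x ∈ list (lookup as i)
  incidences-sound (a ∷ as) ix∈ with ∈-++⁻ (List.map (zero ,_) (list a)) ix∈
  ... | inj₁ ∈a with _ , x∈ , refl ← ∈-map⁻ (zero ,_) ∈a = x∈
  ... | inj₂ ∈as with (i , x) , ix∈′ , refl ← ∈-map⁻ (map₁ suc) ∈as = incidences-sound as ix∈′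

  incidences-unique : ∀ {N} (as : Vec A N) → Unique (incidences as)
  incidences-unique []       = []
  incidences-unique (a ∷ as) = ++⁺
    (map⁺ (cong proj₂) (list-unique a))
    (map⁺ (λ { {i , x} {j , y} eq → cong₂ _,_ (suc-injectiveᶠ (cong proj₁ eq)) (cong proj₂ eq) })
      (incidences-unique as))
    (λ { (∈a , ∈as) → disjoint ∈a ∈as })
    where
    disjoint : ∀ {z} → z ∈ List.map (zero ,_) (list a) → ¬ (z ∈ List.map (map₁ suc) (incidences as))
    disjoint ∈a ∈as with _ , _ , refl ← ∈-map⁻ (zero ,_) ∈a with _ , _ , () ← ∈-map⁻ (map₁ suc) ∈as

  -- Double counting of incidences: within one colour no element lies in two lists, so an incidence
  -- is determined by its colour and its element. The colours will be the trials, the elements nodes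
  -- or edges.
  sum-lengths-≤ : ∀ {N m} (as : Vec A N) (xs : List X) (colour : Fin N → Fin m) →
    (∀ i {x} → x ∈ list (lookup as i) → x ∈ xs) →
    (∀ {i j x} → x ∈ list (lookup as i) → x ∈ list (lookup as j) → colour i ≡ colour j → i ≡ j) →
    Vec.sum (Vec.map (List.length ∘ list) as) ≤ m * List.length xs
  sum-lengths-≤ {m = m} as xs colour ⊆xs separated = begin
    Vec.sum (Vec.map (List.length ∘ list) as) ≡⟨ length-incidences as ⟨
    List.length (incidences as)               ≤⟨ pigeonhole R (incidences-unique as) total injective ⟩
    List.length (cartesianProduct (allFin m) xs) ≡⟨ length-cartesianProductWith _,_ (allFin m) xs ⟩
    List.length (allFin m) * List.length xs
      ≡⟨ cong (_* List.length xs) (Listₚ.length-tabulate {n = m} id) ⟩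
    m * List.length xs                        ∎
    where
    open ≤-Reasoning
    R : _ → _ → Set
    R (i , x) (r , y) = x ∈ list (lookup as i) × colour i ≡ r × x ≡ y
    total : ∀ {ix} → ix ∈ incidences as → ∃[ ry ] (ry ∈ cartesianProduct (allFin m) xs × R ix ry)
    total {i , x} ix∈ with x∈ ← incidences-sound as ix∈ =
      (colour i , x) , ∈-cartesianProduct⁺ (∈-allFin (colour i)) (⊆xs i x∈) , x∈ , refl , refl
    injective : ∀ {ix jy rz} → R ix rz → R jy rz → ix ≡ jy
    injective (x∈ , refl , refl) (y∈ , r≡ , refl) = cong (_, _) (separated x∈ y∈ (sym r≡))

module CoverProof
  (n b reps L D : ℕ) (n≤2^b : n ≤ 2 ^ b) (b≥1 : 1 ≤ b) (ℓ : ℕ) (W : ℚ) (0<W : 0ℚ ℚ.< W)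
  (G : WeightedGraph n) (ω : Vec (Vec Bool (reps * L)) n)
  where

  T : ℕ
  T = D * L

  κ : ℚ → ℕ
  κ = rounded ℓ W

  open Program n b reps L D T n≤2^b κ
  open Run b≥1 G (rounded≥1 ℓ W) ω
  open Rounded G κ

  wake≤T : ∀ r v → wakeAt r v ≤ T
  wake≤T r v = launch≤ L D (chunk reps L (lookup ω v) r)

  cover : Vec (Subset n) (reps * n)
  cover = clusters program G ω

  isCentre-sound : ∀ c z → isCentre c z ≡ true → ∃[ τ ] z ≡ just (c , τ)
  isCentre-sound c (just (c′ , τ)) eq with c ≟ᶠ c′
  ... | yes refl = τ , refl

  isCentre-complete : ∀ c τ → isCentre c (just (c , τ)) ≡ true
  isCentre-complete c τ with c ≟ᶠ c
  ... | yes _  = refl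
  ... | no c≢c = contradiction refl c≢c

  InCluster : Fin (reps * n) → Fin n → Set
  InCluster i v = Trial.In (proj₁ (remQuot {reps} n i)) T (proj₂ (remQuot {reps} n i)) v

  lookup-cover : ∀ i v → lookup (lookup cover i) v
    ≡ isCentre (proj₂ (remQuot {reps} n i)) (Trial.capture (proj₁ (remQuot {reps} n i)) T v)
  lookup-cover i v = begin
    lookup (lookup cover i) v
      ≡⟨ lookup-transpose (tabulate (λ u → output program (state (rounds program) u))) i v ⟩
    lookup (lookup (tabulate (λ u → output program (state (rounds program) u))) v) i
      ≡⟨ cong (λ out → lookup out i)
           (Vecₚ.lookup∘tabulate (λ u → output program (state (rounds program) u)) v) ⟩
    lookup (output program (state (rounds program) v)) i
      ≡⟨ Vecₚ.lookup∘tabulate (λ i → isCentre (proj₂ (remQuot {reps} n i))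
           (Memory.caught (state (rounds program) v) (proj₁ (remQuot {reps} n i)))) i ⟩
    isCentre (proj₂ (remQuot {reps} n i))
        (Memory.caught (state (rounds program) v) (proj₁ (remQuot {reps} n i)))
      ≡⟨ cong (isCentre (proj₂ (remQuot {reps} n i))) (final-sync v (proj₁ (remQuot {reps} n i))) ⟩
    isCentre (proj₂ (remQuot {reps} n i)) (Trial.capture (proj₁ (remQuot {reps} n i)) T v) ∎
    where open ≡-Reasoning

  ∈⇒In : ∀ i {v} → v ∈ˢ lookup cover i → InCluster i v
  ∈⇒In i {v} v∈ = isCentre-sound _ _ (trans (sym (lookup-cover i v)) (Vecₚ.[]=⇒lookup v∈))

  In⇒∈ : ∀ i {v} → InCluster i v → v ∈ˢ lookup cover i
  In⇒∈ i {v} (τ , cap) = Vecₚ.lookup⇒[]= v (lookup cover i)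
    (trans (lookup-cover i v) (trans (cong (isCentre (proj₂ (remQuot {reps} n i))) cap)
      (isCentre-complete (proj₂ (remQuot {reps} n i)) τ)))

  separated : ∀ {i j v} → v ∈ˢ lookup cover i → v ∈ˢ lookup cover j →
    proj₁ (remQuot {reps} n i) ≡ proj₁ (remQuot {reps} n j) → i ≡ j
  separated {i} {j} v∈i v∈j r≡ = begin
    i                                          ≡⟨ combine-remQuot {reps} n i ⟨
    uncurry combine (remQuot {reps} n i)       ≡⟨ cong₂ combine r≡ (same r≡ (∈⇒In i v∈i) (∈⇒In j v∈j)) ⟩
    uncurry combine (remQuot {reps} n j)       ≡⟨ combine-remQuot {reps} n j ⟩
    j                                          ∎
    where
    open ≡-Reasoning
    same : ∀ {r r′ c c′ v} → r ≡ r′ → Trial.In r T c v → Trial.In r′ T c′ v → c ≡ c′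
    same refl (_ , cap) (_ , cap′) = cong proj₁ (just-injective (trans (sym cap) cap′))

  cluster-diameter : ∀ i u v → u ∈ˢ lookup cover i → v ∈ˢ lookup cover i →
    Σ[ p ∈ Walk G u v ] ((p ⊆ᵖ lookup cover i) × cost p ≤ T + T)
  cluster-diameter i u v u∈ v∈ =
    join (to-centre u∈) (to-centre v∈)
    where
    r = proj₁ (remQuot {reps} n i)
    c = proj₂ (remQuot {reps} n i)
    to-centre : ∀ {x} → x ∈ˢ lookup cover i → Σ[ p ∈ Walk G x c ] ((p ⊆ᵖ lookup cover i) × cost p ≤ T)
    to-centre x∈ =
      let p , ins , p≤ = Trial.centre-walk r (∈⇒In i x∈) in p , All.map (In⇒∈ i) ins , p≤
    join : (Σ[ p ∈ Walk G u c ] ((p ⊆ᵖ lookup cover i) × cost p ≤ T)) →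
      (Σ[ p ∈ Walk G v c ] ((p ⊆ᵖ lookup cover i) × cost p ≤ T)) →
      Σ[ p ∈ Walk G u v ] ((p ⊆ᵖ lookup cover i) × cost p ≤ T + T)
    join (p , p⊆ , p≤) (q , q⊆ , q≤) = p ++ʷ reverse q
      , joinAtStart-All (reverse p) (reverse q) (reverse-All p p⊆) (reverse-All q q⊆)
      , ≤-trans (≤-reflexive (trans (cost-++ p (reverse q)) (cong (cost p +_) (cost-reverse q))))
          (+-mono-≤ p≤ q≤)
      where
      reverse-All : ∀ {x y} (p : Walk G x y) → p ⊆ᵖ lookup cover i → reverse p ⊆ᵖ lookup cover i
      reverse-All p p⊆ = joinAtStart-All p nil p⊆ (start-All p p⊆ ∷ [])

  -- The padding property of low-diameter decompositions: around each node, some trial leaves the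
  -- ball of radius 3ℓ uncut.
  Covering : Set
  Covering = ∀ u → ∃[ r ] ∃[ v ] (∀ {x} (q : Walk G x u) → cost q ≤ 3 * ℓ → Trial.In r T v x)

  open Distance G κ (rounded≥1 ℓ W) T

  gaps⇒covering : .{{_ : NonZero n}} (6ℓ<D : 3 * ℓ + 3 * ℓ < D) →
    (∀ u → ∃[ r ] Gap L D (3 * ℓ + 3 * ℓ) 6ℓ<D (dist u) (trial reps L ω r)) → Covering
  gaps⇒covering 6ℓ<D gaps u =
    let r , v , gap = gaps u
    in r , v , gap⇒ball-captured (wakeAt r) (wake≤T r) λ c c≢v →
      subst₂ (λ x y → launch L D x + dist u v + (3 * ℓ + 3 * ℓ) < launch L D y + dist u c)
        (lookup-trial v) (lookup-trial c) (gap c c≢v)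
    where
    lookup-trial : ∀ {r} x → lookup (trial reps L ω r) x ≡ chunk reps L (lookup ω x) r
    lookup-trial x = Vecₚ.lookup∘tabulate _ x

  -- Here all waves start at time 0 and no gap can be forced. However, edges cost at least 1, so a
  -- ball of radius 0 is its own centre, and any trial serves.
  ℓ≡0⇒covering : ℓ ≡ 0 → Fin reps → Covering
  ℓ≡0⇒covering refl r u =
    let (v , τ) , cap = captured-by-T (wakeAt r) (wake≤T r) u
    in r , v , λ { nil _ → τ , cap ; (step _ _) () }

  isCover : ∀ {K} → T + T ≤ K * ⌈log₂ n ⌉ * ℓ → reps ≤ K * ⌈log₂ n ⌉ →
    Covering → IsPairwiseCover K 1 G W (λ p → hops p ≤ ℓ × length p ℚ.≤ fromℕ 2 ℚ.* W) cover
  isCover {K} 2T≤ reps≤ covering = record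
    { diameter  = VecAllₚ.lookup⁻ λ i u v u∈ v∈ →
        let p , p⊆ , p≤ = cluster-diameter i u v u∈ v∈
        in p , p⊆ , cheap⇒short G ℓ W 0<W (K * ⌈log₂ n ⌉) p (≤-trans p≤ 2T≤)
    ; vertexSum = begin
        Vec.sum (Vec.map ∣_∣ cover) ≡⟨ cong Vec.sum (Vecₚ.map-cong (sym ∘ length-members) cover) ⟩
        Vec.sum (Vec.map (List.length ∘ members) cover)
          ≤⟨ sum-lengths-≤ members members-unique cover (allFin n) trialOf (λ _ _ → ∈-allFin _)
               (λ {i} {j} x∈i x∈j → separated
                 (members-sound (lookup cover i) x∈i) (members-sound (lookup cover j) x∈j)) ⟩
        reps * List.length (allFin n) ≡⟨ cong (reps *_) (Listₚ.length-tabulate {n = n} id) ⟩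
        reps * n ≤⟨ crowding n ⟩
        K * (n * ⌈log₂ n ⌉ ^ 1) ∎
    ; edgeSum   = ≤-trans
        (sum-lengths-≤ (edgesWithin G) edgesWithin-unique cover (edges G) trialOf
          (λ i e∈ → proj₁ (edgesWithin-sound (lookup cover i) e∈))
          -- Two clusters containing an edge share its first endpoint, so disjointness for nodes
          -- carries over to edges.
          (λ {i} {j} e∈i e∈j → separated (proj₂ (edgesWithin-sound (lookup cover i) e∈i))
                                         (proj₂ (edgesWithin-sound (lookup cover j) e∈j))))
        (crowding (List.length (edges G)))
    ; covers    = λ {u} p _ (hops≤ , length≤) →
        let r , v , ball = covering u
            p-cheap = short⇒cheap G ℓ W 0<W p hops≤ length≤
        in any-lookup cover (combine r v) (All.map
          (λ { {x} (q , q≤) → In⇒∈ (combine r v)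
            (subst (λ rc → Trial.In (proj₁ rc) T (proj₂ rc) x) (sym (remQuot-combine r v))
              (ball q (≤-trans q≤ p-cheap))) })
          (walks-to-start p))
    }
    where
    open ≤-Reasoning
    trialOf : Fin (reps * n) → Fin reps
    trialOf i = proj₁ (remQuot {reps} n i)
    crowding : ∀ k → reps * k ≤ K * (k * ⌈log₂ n ⌉ ^ 1)
    crowding k = ≤-trans (*-monoˡ-≤ k reps≤) (≤-reflexive
      (trans (shuffle K ⌈log₂ n ⌉ k) (cong (λ l → K * (k * l)) (sym (^-identityʳ ⌈log₂ n ⌉)))))
      where
      shuffle : ∀ K l k → K * l * k ≡ K * (k * l)
      shuffle = solve-∀
    edgesWithin-unique : ∀ C → Unique (edgesWithin G C)
    edgesWithin-unique C = filter⁺ _ (filter⁺ _ (cartesianProduct⁺ (allFin⁺ n) (allFin⁺ n)))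
    edgesWithin-sound : ∀ C {e} → e ∈ edgesWithin G C → e ∈ edges G × proj₁ e ∈ˢ C
    edgesWithin-sound C e∈ =
      let e∈edges , u∈ , _ = ∈-filter⁻ (λ (u , v) → (u ∈? C) ×-dec (v ∈? C)) {xs = edges G} e∈
      in e∈edges , u∈

-- Choice of constants and conclusion

module Parameters (c : ℕ) where

  trialsPerLog : ℕ
  trialsPerLog = 3 * suc c

  -- The factor 14 is 7 · 2: a trial lasts 7ℓ times 2 log n rounds. Multiplied by the trials per
  -- logarithm this is the constant for the rounds, and it is large enough for the diameter and for
  -- the two sums.
  K : ℕ
  K = 14 * trialsPerLog

  trials coinsPerTrial : ℕ → ℕ
  trials n = trialsPerLog * ⌈log₂ n ⌉
  coinsPerTrial n = 2 * ⌈log₂ n ⌉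

  n≤2^1*log : ∀ n → n ≤ 2 ^ (1 * ⌈log₂ n ⌉)
  n≤2^1*log n = subst (λ k → n ≤ 2 ^ k) (sym (*-identityˡ ⌈log₂ n ⌉)) (n≤2^⌈log₂n⌉ n)

  algorithm : AlgorithmFamily 1
  algorithm n ℓ W = Program.program n (1 * ⌈log₂ n ⌉) (trials n) (coinsPerTrial n) (7 * ℓ)
    (7 * ℓ * coinsPerTrial n) (n≤2^1*log n) (rounded ℓ W)

  rounds-bound : ∀ n ℓ W → rounds (algorithm n ℓ W) ≤ K * (ℓ * ⌈log₂ n ⌉ ^ 2)
  rounds-bound n ℓ W = ≤-reflexive (trans (length-roundRobin {trials n} (7 * ℓ * coinsPerTrial n))
    (regroup ℓ ⌈log₂ n ⌉ trialsPerLog))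
    where
    regroup : ∀ ℓ l a → 7 * ℓ * (2 * l) * (a * l) ≡ 14 * a * (ℓ * (l * (l * 1)))
    regroup = solve-∀

  -- Three trials per binary digit of n ^ suc c suffice since 2 · 3³ ≤ 4³.
  enough-trials : ∀ n → n ^ c * (n * 3 ^ trials n) ≤ 4 ^ trials n
  enough-trials n = begin
    n ^ c * (n * 3 ^ trials n)      ≡⟨ cong (λ t → n ^ c * (n * 3 ^ t)) trials≡3k ⟩
    n ^ c * (n * 3 ^ (3 * k))       ≡⟨ regroup (n ^ c) n (3 ^ (3 * k)) ⟩
    n ^ suc c * 3 ^ (3 * k)         ≤⟨ *-monoˡ-≤ (3 ^ (3 * k)) (^-monoˡ-≤ (suc c) (n≤2^⌈log₂n⌉ n)) ⟩
    (2 ^ ⌈log₂ n ⌉) ^ suc c * 3 ^ (3 * k)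
      ≡⟨ cong₂ _*_ (trans (^-*-assoc 2 ⌈log₂ n ⌉ (suc c)) (cong (2 ^_) (*-comm ⌈log₂ n ⌉ (suc c))))
                   (sym (^-*-assoc 3 3 k)) ⟩
    2 ^ k * 27 ^ k                  ≡⟨ ^-distribʳ-* k 2 27 ⟨
    54 ^ k                          ≤⟨ ^-monoˡ-≤ k (m≤m+n 54 10) ⟩
    64 ^ k                          ≡⟨ ^-*-assoc 4 3 k ⟩
    4 ^ (3 * k)                     ≡⟨ cong (4 ^_) trials≡3k ⟨
    4 ^ trials n                    ∎
    where
    open ≤-Reasoning
    k : ℕ
    k = suc c * ⌈log₂ n ⌉
    trials≡3k : trials n ≡ 3 * k
    trials≡3k = *-assoc 3 (suc c) ⌈log₂ n ⌉
    regroup : ∀ p n t → p * (n * t) ≡ n * p * t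
    regroup = solve-∀

  -- A cover for a class of paths is a cover for every subclass; this class contains those of both
  -- claims.
  ReachCover : ∀ {n N} → WeightedGraph n → ℕ → ℚ → Vec _ N → Set
  ReachCover G ℓ W = IsPairwiseCover K 1 G W (λ p → hops p ≤ ℓ × length p ℚ.≤ fromℕ 2 ℚ.* W)

  module _ {n : ℕ} (n≥2 : 2 ≤ n) (G : WeightedGraph n) (ℓ : ℕ) (W : ℚ) (0<W : 0ℚ <ℚ W) where

    private
      L reps : ℕ
      L    = coinsPerTrial n
      reps = trials n

      instance
        n≢0 : NonZero n
        n≢0 = >-nonZero (≤-trans (s≤s z≤n) n≥2)

    log≥1 : 1 ≤ ⌈log₂ n ⌉
    log≥1 = ⌈log₂⌉-mono-≤ n≥2

    open module Proof = CoverProof n (1 * ⌈log₂ n ⌉) reps L (7 * ℓ) (n≤2^1*log n)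
        (subst (1 ≤_) (sym (*-identityˡ ⌈log₂ n ⌉)) log≥1) ℓ W 0<W G using (Covering)

    open Distance G (rounded ℓ W) (rounded≥1 ℓ W) (7 * ℓ * L) using (dist)

    covering⇒cover : ∀ ω → Covering ω → ReachCover G ℓ W (clusters (algorithm n ℓ W) G ω)
    covering⇒cover ω = Proof.isCover ω {K} 2T≤ (*-monoˡ-≤ ⌈log₂ n ⌉ (m≤n*m trialsPerLog 14))
      where
      open ≤-Reasoning
      double : ∀ ℓ l → 7 * ℓ * (2 * l) + 7 * ℓ * (2 * l) ≡ 14 * 2 * (l * ℓ)
      double = solve-∀
      2T≤ : 7 * ℓ * L + 7 * ℓ * L ≤ K * ⌈log₂ n ⌉ * ℓ
      2T≤ = begin
        7 * ℓ * L + 7 * ℓ * L       ≡⟨ double ℓ ⌈log₂ n ⌉ ⟩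
        14 * 2 * (⌈log₂ n ⌉ * ℓ)    ≤⟨ *-monoˡ-≤ (⌈log₂ n ⌉ * ℓ) (*-monoʳ-≤ 14
                                        (≤-trans (m≤m+n 2 1) (*-monoʳ-≤ 3 (s≤s (z≤n {c}))))) ⟩
        K * (⌈log₂ n ⌉ * ℓ)         ≡⟨ *-assoc K ⌈log₂ n ⌉ ℓ ⟨
        K * ⌈log₂ n ⌉ * ℓ           ∎

    -- One logarithm of coins pays for the union over the n nodes, the other for making truncation
    -- at most as likely as 1/2.
    enough-coins : n * 2 ≤ 2 ^ L
    enough-coins = begin
      n * 2                           ≤⟨ *-mono-≤ (n≤2^⌈log₂n⌉ n) (^-monoʳ-≤ 2 log≥1) ⟩
      2 ^ ⌈log₂ n ⌉ * 2 ^ ⌈log₂ n ⌉   ≡⟨ ^-distribˡ-+-* 2 ⌈log₂ n ⌉ ⌈log₂ n ⌉ ⟨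
      2 ^ (⌈log₂ n ⌉ + ⌈log₂ n ⌉)     ≡⟨ cong (λ l → 2 ^ (⌈log₂ n ⌉ + l)) (+-identityʳ ⌈log₂ n ⌉) ⟨
      2 ^ L                           ∎
      where open ≤-Reasoning

    constructs-zero : ℓ ≡ 0 → ConstructsWHP (algorithm n ℓ W) G c (ReachCover G ℓ W)
    constructs-zero ℓ≡0 = elements Ω₀
      , unique Ω₀ , All.tabulate (λ {ω} _ → covering⇒cover ω (Proof.ℓ≡0⇒covering ω ℓ≡0 trial₀))
      , ≤-trans (*-monoʳ-≤ (n ^ c) (≤-reflexive (sym (size-outcomes n reps L)))) (m≤m+n _ _)
      where
      Ω₀ : Finite (Vec (Vec Bool (reps * L)) n)
      Ω₀ = vectors (vectors bools (reps * L)) n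
      trial₀ : Fin reps
      -- The number of trials is positive, since `3 * suc c` unfolds to `suc (c + 2 * suc c)` and
      -- the logarithm is at least 1.
      trial₀ = fromℕ< {0} (*-mono-≤ (s≤s (z≤n {c + 2 * suc c})) log≥1)

    constructs-positive : 1 ≤ ℓ → ConstructsWHP (algorithm n ℓ W) G c (ReachCover G ℓ W)
    constructs-positive ℓ≥1 = good , good-unique
      , All.map (λ {ω} gaps → covering⇒cover ω (Proof.gaps⇒covering ω 6ℓ<7ℓ gaps)) good-Good
      , good-probability c (enough-trials n)
      where
      6ℓ<7ℓ : 3 * ℓ + 3 * ℓ < 7 * ℓ
      6ℓ<7ℓ = begin
        1 + (3 * ℓ + 3 * ℓ)   ≤⟨ +-monoˡ-≤ (3 * ℓ + 3 * ℓ) ℓ≥1 ⟩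
        ℓ + (3 * ℓ + 3 * ℓ)   ≡⟨ regroup ℓ ⟩
        7 * ℓ                 ∎
        where
        open ≤-Reasoning
        regroup : ∀ ℓ → ℓ + (3 * ℓ + 3 * ℓ) ≡ 7 * ℓ
        regroup = solve-∀
      open Amplification n reps L
        (λ u → gap? L (7 * ℓ) (3 * ℓ + 3 * ℓ) 6ℓ<7ℓ (dist u))
        (λ u → nonGaps-bound L (7 * ℓ) (3 * ℓ + 3 * ℓ) 6ℓ<7ℓ (dist u) enough-coins)

    constructs-large : ConstructsWHP (algorithm n ℓ W) G c (ReachCover G ℓ W)
    constructs-large =
      [ (λ ℓ≥1 → constructs-positive ℓ≥1) , (λ ℓ≡0 → constructs-zero (sym ℓ≡0)) ]′ (m≤n⇒m<n∨m≡n (z≤n {ℓ}))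

  -- Here the required probability 1 - n^-c is at most 0.
  constructs-small : ∀ {n} → n ≤ 1 → (G : WeightedGraph n) → ∀ ℓ W →
    ConstructsWHP (algorithm n ℓ W) G c (ReachCover G ℓ W)
  constructs-small {n} n≤1 G ℓ W = [] , [] , [] , (begin
    n ^ c * Y                    ≤⟨ *-monoˡ-≤ Y (^-monoˡ-≤ c n≤1) ⟩
    1 ^ c * Y                    ≡⟨ cong (_* Y) (^-zeroˡ c) ⟩
    1 * Y                        ≡⟨ *-identityˡ Y ⟩
    Y                            ≤⟨ m≤n+m Y (n ^ c * 0) ⟩
    n ^ c * 0 + Y                ∎)
    where
    open ≤-Reasoning
    Y = 2 ^ (n * coins (algorithm n ℓ W))

  constructs : ∀ n (G : WeightedGraph n) ℓ W → 0ℚ <ℚ W →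
    ConstructsWHP (algorithm n ℓ W) G c (ReachCover G ℓ W)
  constructs n G ℓ W 0<W =
    [ (λ n≤1 → constructs-small n≤1 G ℓ W) , (λ n≥2 → constructs-large n≥2 G ℓ W 0<W) ]′ (≤-<-connex n 1)

  constructs-for : ∀ n (G : WeightedGraph n) ℓ W → 0ℚ <ℚ W → (Covered : PathClass G) →
    (∀ {u v} (p : Walk G u v) → Covered p → hops p ≤ ℓ × length p ℚ.≤ fromℕ 2 ℚ.* W) →
    ConstructsWHP (algorithm n ℓ W) G c (IsPairwiseCover K 1 G W Covered)
  constructs-for n G ℓ W 0<W Covered covered⇒ =
    let good , good-unique , good-covers , bound = constructs n G ℓ W 0<W
    in good , good-unique , All.map restrict good-covers , bound
    where
    restrict : ∀ {ω} → ReachCover G ℓ W (clusters (algorithm n ℓ W) G ω) →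
      IsPairwiseCover K 1 G W Covered (clusters (algorithm n ℓ W) G ω)
    restrict cover = record
      { diameter = diameter ; vertexSum = vertexSum ; edgeSum = edgeSum
      ; covers = λ p path q → covers p path (covered⇒ p q) }
      where open IsPairwiseCover cover

theorem3 : (c d : ℕ) →
    (∃[ B ] ∃[ K ] ∃[ e ] Σ (AlgorithmFamily B) λ A →
    (n : ℕ) (G : WeightedGraph n) → PolynomiallyBounded d G →
    (ℓ : ℕ) (W : ℚ) → 0ℚ <ℚ W →
    (rounds (A n ℓ W) ≤ K * (ℓ * ⌈log₂ n ⌉ ^ 2 * suc ⌈log₂ℚ W ⌉))
    × ConstructsWHP (A n ℓ W) G c (IsLimitedPairwiseCover K e G ℓ W))
    ×
    (∃[ B ] ∃[ K ] ∃[ e ] Σ (AlgorithmFamily B) λ A →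
    (n : ℕ) (G : WeightedGraph n) → PolynomiallyBounded d G →
    (ℓ : ℕ) (W : ℚ) → 0ℚ <ℚ W →
    (rounds (A n ℓ W) ≤ K * (ℓ * ⌈log₂ n ⌉ ^ 2))
    × ConstructsWHP (A n ℓ W) G c (IsScalePairwiseCover K e G ℓ W))
theorem3 c d =
  ( 1 , K , 1 , algorithm , λ n G _ ℓ W 0<W →
      -- The factor for the scales is at least 1, so the bound for a single scale implies this one.
      ≤-trans (rounds-bound n ℓ W) (*-monoʳ-≤ K (m≤m*n (ℓ * ⌈log₂ n ⌉ ^ 2) (suc ⌈log₂ℚ W ⌉)))
    , constructs-for n G ℓ W 0<W (λ p → hops p ≤ ℓ × length p ℚ.≤ W)
        (λ { p (hops≤ , length≤W) → hops≤ , ≤-double 0<W length≤W }) )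
  , ( 1 , K , 1 , algorithm , λ n G _ ℓ W 0<W →
      rounds-bound n ℓ W
    , constructs-for n G ℓ W 0<W (λ p → hops p ≤ ℓ × W ℚ.≤ length p × length p ℚ.≤ fromℕ 2 ℚ.* W)
        (λ { p (hops≤ , _ , length≤2W) → hops≤ , length≤2W }) )
  where
  open Parameters c
  ≤-double : ∀ {x W} → 0ℚ <ℚ W → x ℚ.≤ W → x ℚ.≤ fromℕ 2 ℚ.* W
  ≤-double {x} {W} 0<W x≤W = begin
    x                 ≤⟨ x≤W ⟩
    W                 ≡⟨ ℚₚ.*-identityˡ W ⟨
    1ℚ ℚ.* W
      ≤⟨ ℚₚ.*-monoʳ-≤-nonNeg W {{ℚ.nonNegative (ℚₚ.<⇒≤ 0<W)}} (fromℕ-mono-≤ {1} {2} (s≤s z≤n)) ⟩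
    fromℕ 2 ℚ.* W     ∎
    where open ℚₚ.≤-Reasoning
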